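{- Let $\ell \geq 3$ be an integer and let $n_1,n_2 \geq \ell+2$. Then $$sat(K_{n_1,n_2},C_{2\ell}) \leq n_1+n_2+\ell^2-3\ell+1.$$ Moreover, $sat(K_{n_1,n_2},C_6) = n_1+n_2+1$ (for $n_1,n_2 \ge 5$).
   Context: All graphs are finite, simple and undirected. $K_{n_1,n_2}$ is the complete bipartite graph with parts of sizes $n_1$ and $n_2$. $C_r$ denotes the cycle on $r$ vertices. For graphs $G$ and $F$, a spanning subgraph $H$ of $G$ is $F$-saturated relative to $G$ if $H$ contains no copy of $F$ but $H+e$ contains a copy of $F$ for every $e\in E(G)\setminus E(H)$; $sat(G,F)$ is the minimum number of edges of a graph that is $F$-saturated relative to $G$. -}

module Defs where

open import Data.Nat using (ℕ; zero; suc; _+_; _*_; _∸_; _≤_; _<ᵇ_; _≡ᵇ_)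
open import Data.Fin using (Fin; toℕ; _≟_)
open import Data.Bool using (Bool; true; false; _∧_; _∨_; if_then_else_; _xor_)
open import Data.List using (List; map; allFin)
open import Data.Nat.ListAction using (sum)
open import Data.Product using (Σ; _×_; ∃)
open import Relation.Nullary using (¬_; does)
open import Relation.Binary.PropositionalEquality using (_≡_)
open import Function.Definitions using (Injective)

Adj : ℕ → Set
Adj n = Fin n → Fin n → Bool

IsGraph : ∀ {n} → Adj n → Set
IsGraph {n} A = (∀ (i j : Fin n) → A i j ≡ A j i) × (∀ (i : Fin n) → A i i ≡ false)

IsSpanningSubgraph : ∀ {n} → Adj n → Adj n → Set
IsSpanningSubgraph {n} H G = IsGraph H × (∀ (i j : Fin n) → H i j ≡ true → G i j ≡ true)

edgeCount : ∀ {n} → Adj n → ℕ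
edgeCount {n} A =
  sum (map (λ i → sum (map (λ j → if (toℕ i <ᵇ toℕ j) ∧ A i j then 1 else 0) (allFin n))) (allFin n))

addEdge : ∀ {n} → Adj n → Fin n → Fin n → Adj n
addEdge H u v i j = H i j ∨ ((does (i ≟ u) ∧ does (j ≟ v)) ∨ (does (i ≟ v) ∧ does (j ≟ u)))

ContainsCopy : ∀ {n r} → Adj n → Adj r → Set
ContainsCopy {n} {r} H F =
  Σ (Fin r → Fin n) λ φ → Injective _≡_ _≡_ φ × (∀ (i j : Fin r) → F i j ≡ true → H (φ i) (φ j) ≡ true)

IsSaturated : ∀ {n r} → Adj n → Adj r → Adj n → Set
IsSaturated {n} G F H =
  IsSpanningSubgraph H G × ¬ ContainsCopy H F ×
  (∀ (u v : Fin n) → G u v ≡ true → H u v ≡ false → ContainsCopy (addEdge H u v) F)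

SatLE : ∀ {n r} → Adj n → Adj r → ℕ → Set
SatLE {n} G F m = Σ (Adj n) λ H → IsSaturated G F H × edgeCount H ≤ m

SatEq : ∀ {n r} → Adj n → Adj r → ℕ → Set
SatEq {n} G F m =
  (Σ (Adj n) λ H → IsSaturated G F H × edgeCount H ≡ m) ×
  (∀ (H : Adj n) → IsSaturated G F H → m ≤ edgeCount H)

K : (n₁ n₂ : ℕ) → Adj (n₁ + n₂)
K n₁ n₂ i j = (toℕ i <ᵇ n₁) xor (toℕ j <ᵇ n₁)

cycleStep : (r : ℕ) → Fin r → Fin r → Bool
cycleStep r i j = (toℕ j ≡ᵇ suc (toℕ i)) ∨ ((toℕ i ≡ᵇ r ∸ 1) ∧ (toℕ j ≡ᵇ 0))

C : (r : ℕ) → Adj r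
C r i j = cycleStep r i j ∨ cycleStep r j i

{-# OPTIONS --safe #-}

-- Upper bound: take K_{ℓ,ℓ-1}, hang one vertex y₀ off a vertex of the larger part A, hang all remaining vertices
-- of A's side off y₀, and all remaining vertices of the other side off a second vertex of A.  The pendant trees lie
-- on no cycle and K_{ℓ,ℓ-1} has too few vertices for C₂ℓ, while every missing edge closes a cycle using almost all
-- of K_{ℓ,ℓ-1}.
--
-- Lower bound for C₆: two non-adjacent vertices on opposite sides are joined by a path of length 5.  This forces
-- trees hanging off the 2-core to have depth at most 2.  Every edge has weight 2 to distribute over its ends: a tree
-- edge gives everything to the end farther from the core, a core edge gives 1 to either end; then each vertex
-- receives at least 2.  Hence there are at least as many edges as vertices, with equality only if the 2-core is
-- 2-regular, and then it is a C₄ or C₈ that is a whole component, which is too small.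
module Submission where

open import Defs
open import Data.Bool using (Bool; true; false; not; _∧_; _∨_; if_then_else_; _xor_; T)
open import Data.Bool.Properties using (∨-comm; ∨-zeroʳ; ∧-comm; ∧-zeroʳ; ¬-not; not-¬)
import Data.Bool.Properties as Bool
open import Data.Empty using (⊥; ⊥-elim)
open import Data.Fin
  using ( Fin; zero; suc; toℕ; _≟_; cast; combine; remQuot; _↑ˡ_; _↑ʳ_; inject≤; inject₁; splitAt; join
        ; fromℕ; fromℕ<)
open import Data.Fin.Patterns using (0F; 1F; 2F; 3F; 4F; 5F)
open import Data.Fin.Permutation.Components using (transpose; transpose-inverse)
open import Data.Fin.Properties
  using ( toℕ-injective; toℕ-cast; toℕ-combine; combine-remQuot; cast-involutive; any?; all?; ¬∀⟶∃¬; pigeonhole; <⇒≢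
        ; toℕ<n; toℕ-↑ˡ; toℕ-↑ʳ; ↑ˡ-injective; ↑ʳ-injective; inject≤-injective; splitAt-↑ˡ; splitAt-↑ʳ; splitAt-join
        ; join-splitAt; toℕ-fromℕ; toℕ-fromℕ<; toℕ-inject₁)
import Data.List as List
open import Data.List.Properties using (map-tabulate)
open import Data.Nat using (ℕ; zero; suc; _+_; _*_; _∸_; _≤_; _<_; _<ᵇ_; _≡ᵇ_; z≤n; s≤s; _<?_)
import Data.Nat.ListAction as ListAction
open import Data.Nat.Properties hiding (_≟_; <⇒≢)
open import Data.Nat.Tactic.RingSolver using (solve-∀)
open import Data.Product using (_×_; _,_; proj₁; proj₂; ∃; ∃₂; uncurry)
open import Data.Sum as Sum using (_⊎_; inj₁; inj₂; [_,_]′; swap)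
open import Data.Sum.Properties using (inj₁-injective; inj₂-injective)
open import Data.Vec.Functional using (Vector; []; _∷_; updateAt)
open import Data.Vec.Functional.Properties using (updateAt-minimal; updateAt-updates)
open import Function using (_∘_; id; const)
open import Function.Definitions using (Injective)
open import Relation.Binary using (tri<; tri≈; tri>)
open import Relation.Binary.PropositionalEquality
open import Relation.Nullary using (¬_; Dec; yes; no; does; contradiction; ¬?; _×-dec_; _→-dec_)
open import Relation.Nullary.Decidable using (decidable-stable; from-yes; dec-true; dec-false)
open import Algebra.Properties.CommutativeMonoid.Sum +-0-commutativeMonoid
  using (sum; sum-syntax; sum-cong-≗; ∑-comm; ∑-distrib-+)
open import Algebra.Properties.CommutativeSemigroup +-commutativeSemigroup using (interchange)

-- Boolean reflection and even cycles

≡true⇒T : ∀ {b} → b ≡ true → T b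
≡true⇒T refl = _

T⇒≡true : ∀ {b} → T b → b ≡ true
T⇒≡true {true} _ = refl

∨-true⁻ : ∀ {x y} → x ∨ y ≡ true → x ≡ true ⊎ y ≡ true
∨-true⁻ {true}  _ = inj₁ refl
∨-true⁻ {false} e = inj₂ e

∧-true⁻ : ∀ {x y} → x ∧ y ≡ true → x ≡ true × y ≡ true
∧-true⁻ {true} e = refl , e

≡ᵇ-true⁻ : ∀ {m n} → (m ≡ᵇ n) ≡ true → m ≡ n
≡ᵇ-true⁻ {m} {n} e = ≡ᵇ⇒≡ m n (≡true⇒T e)

≡ᵇ-true⁺ : ∀ {m n} → m ≡ n → (m ≡ᵇ n) ≡ true
≡ᵇ-true⁺ {m} {n} e = T⇒≡true (≡⇒≡ᵇ m n e)

does-true⁻ : ∀ {p} {P : Set p} (d : Dec P) → does d ≡ true → P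
does-true⁻ (yes p) _ = p

Next : ∀ {r} → Fin r → Fin r → Set
Next {r} i j = toℕ j ≡ suc (toℕ i) ⊎ (suc (toℕ i) ≡ r × toℕ j ≡ 0)

cycleStep⁻ : ∀ {r} {i j : Fin r} → cycleStep r i j ≡ true → Next i j
cycleStep⁻ {suc r} {i} {j} e with ∨-true⁻ {toℕ j ≡ᵇ suc (toℕ i)} e
... | inj₁ e₁ = inj₁ (≡ᵇ-true⁻ e₁)
... | inj₂ e₂ with e₃ , e₄ ← ∧-true⁻ {toℕ i ≡ᵇ r} e₂ = inj₂ (cong suc (≡ᵇ-true⁻ e₃) , ≡ᵇ-true⁻ {toℕ j} e₄)

cycleStep⁺ : ∀ {r} {i j : Fin r} → Next i j → cycleStep r i j ≡ true
cycleStep⁺ (inj₁ e) rewrite ≡ᵇ-true⁺ e = refl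
cycleStep⁺ {suc r} {i} {j} (inj₂ (e₁ , e₂))
  rewrite ≡ᵇ-true⁺ (suc-injective e₁) | e₂ = refl

Next⇒C : ∀ {r} {i j : Fin r} → Next i j → C r i j ≡ true
Next⇒C e rewrite cycleStep⁺ e = refl

C-sym : ∀ r (i j : Fin r) → C r i j ≡ C r j i
C-sym r i j = ∨-comm (cycleStep r i j) _

C-elim : ∀ {r} (P : Fin r → Fin r → Set) → (∀ {i j} → P i j → P j i) → (∀ {i j} → Next i j → P i j) →
         ∀ i j → C r i j ≡ true → P i j
C-elim {r} P P-sym step i j e with ∨-true⁻ {cycleStep r i j} e
... | inj₁ e₁ = step (cycleStep⁻ e₁)
... | inj₂ e₂ = P-sym (step (cycleStep⁻ {i = j} e₂))

-- The cycle is s 0, t 0, s 1, t 1, …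
module _ {n ℓ} (A : Adj n) (A-sym : ∀ i j → A i j ≡ A j i) (s t : Fin ℓ → Fin n)
         (s-injective : Injective _≡_ _≡_ s) (t-injective : Injective _≡_ _≡_ t) (s≢t : ∀ i j → s i ≢ t j)
         (s~t : ∀ i → A (s i) (t i) ≡ true) (t~s : ∀ {i j} → Next i j → A (t i) (s j) ≡ true) where

  private
    place : Fin ℓ × Fin 2 → Fin n
    place (i , zero)  = s i
    place (i , suc _) = t i

    place-injective : ∀ {x y} → place x ≡ place y → x ≡ y
    place-injective {_ , zero}     {_ , zero}     e = cong (_, zero) (s-injective e)
    place-injective {_ , zero}     {_ , suc _}    e = contradiction e (s≢t _ _)
    place-injective {_ , suc _}    {_ , zero}     e = contradiction (sym e) (s≢t _ _)
    place-injective {_ , suc zero} {_ , suc zero} e = cong (_, suc zero) (t-injective e)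

    coords : Fin (2 * ℓ) → Fin ℓ × Fin 2
    coords k = remQuot {ℓ} 2 (cast (*-comm 2 ℓ) k)

    coords-uncast : ∀ k → cast (*-comm ℓ 2) (uncurry combine (coords k)) ≡ k
    coords-uncast k = trans (cong (cast _) (combine-remQuot {ℓ} 2 _)) (cast-involutive (*-comm ℓ 2) (*-comm 2 ℓ) k)

    coords-injective : ∀ {k l} → coords k ≡ coords l → k ≡ l
    coords-injective {k} {l} e =
      trans (sym (coords-uncast k)) (trans (cong (cast _ ∘ uncurry combine) e) (coords-uncast l))

    toℕ-coords : ∀ k → let i , b = coords k in toℕ k ≡ 2 * toℕ i + toℕ b
    toℕ-coords k = let i , b = coords k in
      trans (sym (cong toℕ (coords-uncast k))) (trans (toℕ-cast _ (combine i b)) (toℕ-combine i b))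

    -- Every step changes the parity of the position, also the wrap from `2ℓ - 1` to `0`, so equal
    -- second coordinates are impossible. The coordinates are arguments, with equations, so that
    -- they can be matched on.
    place-step : ∀ {k l} x y → toℕ k ≡ 2 * toℕ (proj₁ x) + toℕ (proj₂ x) → toℕ l ≡ 2 * toℕ (proj₁ y) + toℕ (proj₂ y) →
                 Next {2 * ℓ} k l → A (place x) (place y) ≡ true
    place-step {k} {l} (i , zero) (j , zero) ek el (inj₁ e) =
      contradiction (trans (sym (trans el (+-identityʳ _))) (trans e (cong suc (trans ek (+-identityʳ _)))))
                    (even≢odd (toℕ j) (toℕ i))
    place-step (i , zero) (j , suc zero) ek el (inj₁ e) =
      subst (λ j → A (s i) (t j) ≡ true) i≡j (s~t i)
      where
      i≡j : i ≡ j
      i≡j = toℕ-injective (*-cancelˡ-≡ (toℕ i) (toℕ j) 2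
        (suc-injective (trans (cong suc (sym (trans ek (+-identityʳ _)))) (trans (sym e) (trans el (+-comm _ 1))))))
    place-step (i , suc zero) (j , zero) ek el (inj₁ e) = t~s (inj₁ (*-cancelˡ-≡ _ _ 2 (begin
      2 * toℕ j             ≡⟨ +-identityʳ _ ⟨
      2 * toℕ j + 0         ≡⟨ el ⟨
      _                     ≡⟨ e ⟩
      suc _                 ≡⟨ cong suc ek ⟩
      suc (2 * toℕ i + 1)   ≡⟨ cong suc (+-comm _ 1) ⟩
      2 + 2 * toℕ i         ≡⟨ *-suc 2 (toℕ i) ⟨
      2 * suc (toℕ i)       ∎)))
      where open ≡-Reasoning
    place-step (i , suc zero) (j , suc zero) ek el (inj₁ e) =
      contradiction (trans (sym (suc-injective (trans (sym e) (trans el (+-comm _ 1))))) (trans ek (+-comm _ 1)))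
                    (even≢odd (toℕ j) (toℕ i))
    place-step (i , zero) (j , _) ek el (inj₂ (e , _)) =
      contradiction (sym (trans (cong suc (sym (trans ek (+-identityʳ _)))) e)) (even≢odd ℓ (toℕ i))
    place-step (i , suc zero) (j , zero) ek el (inj₂ (e , e′)) = t~s (inj₂
      ( *-cancelˡ-≡ _ _ 2 (trans (*-suc 2 (toℕ i)) (trans (cong suc (trans (+-comm 1 _) (sym ek))) e))
      , *-cancelˡ-≡ _ _ 2 (trans (sym (trans el (+-identityʳ _))) e′)))
    place-step (i , suc zero) (j , suc zero) ek el (inj₂ (_ , e′)) with () ← trans (sym e′) (trans el (+-comm _ 1))

  alternating-cycle : ContainsCopy A (C (2 * ℓ))
  alternating-cycle = place ∘ coords , coords-injective ∘ place-injective ,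
    C-elim (λ k l → A (place (coords k)) (place (coords l)) ≡ true) (trans (A-sym _ _))
           (λ {k} {l} → place-step (coords k) (coords l) (toℕ-coords k) (toℕ-coords l))

-- Adding an edge

module _ {n} (H : Adj n) (u v : Fin n) where

  addEdge⁻ : ∀ {i j} → addEdge H u v i j ≡ true →
             H i j ≡ true ⊎ (i ≡ u × j ≡ v) ⊎ (i ≡ v × j ≡ u)
  addEdge⁻ {i} {j} e with ∨-true⁻ {H i j} e
  ... | inj₁ h = inj₁ h
  ... | inj₂ e′ with ∨-true⁻ {does (i ≟ u) ∧ does (j ≟ v)} e′
  ...   | inj₁ f with f₁ , f₂ ← ∧-true⁻ {does (i ≟ u)} f = inj₂ (inj₁ (does-true⁻ (i ≟ u) f₁ , does-true⁻ (j ≟ v) f₂))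
  ...   | inj₂ f with f₁ , f₂ ← ∧-true⁻ {does (i ≟ v)} f = inj₂ (inj₂ (does-true⁻ (i ≟ v) f₁ , does-true⁻ (j ≟ u) f₂))

  addEdge-old : ∀ {i j} → H i j ≡ true → addEdge H u v i j ≡ true
  addEdge-old h rewrite h = refl

  addEdge-new : addEdge H u v u v ≡ true
  addEdge-new with u ≟ u | v ≟ v
  ... | yes _  | yes _  = ∨-zeroʳ _
  ... | no u≢u | _      = contradiction refl u≢u
  ... | yes _  | no v≢v = contradiction refl v≢v

  addEdge-sym : (∀ i j → H i j ≡ H j i) → ∀ i j → addEdge H u v i j ≡ addEdge H u v j i
  addEdge-sym H-sym i j = cong₂ _∨_ (H-sym i j)
    (trans (∨-comm (does (i ≟ u) ∧ _) _) (cong₂ _∨_ (∧-comm (does (i ≟ v)) _) (∧-comm (does (i ≟ u)) _)))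

-- Edge counts and sums over `Fin n`

sum-allFin : ∀ {n} (f : Vector ℕ n) → ListAction.sum (List.map f (List.allFin n)) ≡ sum f
sum-allFin f = trans (cong ListAction.sum (map-tabulate id f)) (sum-tabulate f)
  where
  sum-tabulate : ∀ {n} (f : Vector ℕ n) → ListAction.sum (List.tabulate f) ≡ sum f
  sum-tabulate {zero}  f = refl
  sum-tabulate {suc n} f = cong (f zero +_) (sum-tabulate (f ∘ suc))

edgeIndicator : ∀ {n} → Adj n → Fin n → Fin n → ℕ
edgeIndicator A i j = if (toℕ i <ᵇ toℕ j) ∧ A i j then 1 else 0

edgeCount≡∑ : ∀ {n} (A : Adj n) → edgeCount A ≡ ∑[ i < n ] ∑[ j < n ] edgeIndicator A i j
edgeCount≡∑ {n} A =
  trans (sum-allFin (λ i → ListAction.sum (List.map (edgeIndicator A i) (List.allFin n))))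
        (sum-cong-≗ (λ i → sum-allFin (edgeIndicator A i)))

sum-mono-≤ : ∀ {n} {f g : Vector ℕ n} → (∀ i → f i ≤ g i) → sum f ≤ sum g
sum-mono-≤ {zero}  f≤g = z≤n
sum-mono-≤ {suc n} f≤g = +-mono-≤ (f≤g zero) (sum-mono-≤ (f≤g ∘ suc))

-- The entry is zeroed, not deleted: the remainder keeps its index set, and further entries can be
-- extracted from it.
sum-extract : ∀ {n} (f : Vector ℕ n) i → sum f ≡ f i + sum (updateAt f i (const 0))
sum-extract f zero    = refl
sum-extract f (suc i) = begin
  f zero + sum (f ∘ suc)            ≡⟨ cong (f zero +_) (sum-extract (f ∘ suc) i) ⟩
  f zero + (f (suc i) + rest)       ≡⟨ +-assoc (f zero) _ _ ⟨
  (f zero + f (suc i)) + rest       ≡⟨ cong (_+ rest) (+-comm (f zero) _) ⟩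
  (f (suc i) + f zero) + rest       ≡⟨ +-assoc (f (suc i)) _ _ ⟩
  f (suc i) + (f zero + rest)       ∎
  where
  open ≡-Reasoning
  rest = sum (updateAt (f ∘ suc) i (const 0))

entry≤sum : ∀ {n} (f : Vector ℕ n) i → f i ≤ sum f
entry≤sum f i rewrite sum-extract f i = m≤m+n (f i) _

extract-≤ : ∀ {n} (f : Vector ℕ n) i {m} → m ≤ sum (updateAt f i (const 0)) → f i + m ≤ sum f
extract-≤ f i m≤ rewrite sum-extract f i = +-monoʳ-≤ (f i) m≤

two-entries≤sum : ∀ {n} (f : Vector ℕ n) {i j} → i ≢ j → f i + f j ≤ sum f
two-entries≤sum f {i} {j} i≢j = extract-≤ f i
  (subst (_≤ sum (updateAt f i (const 0))) (updateAt-minimal j i f (i≢j ∘ sym)) (entry≤sum _ j))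

three-entries≤sum : ∀ {n} (f : Vector ℕ n) {i j k} → i ≢ j → i ≢ k → j ≢ k → f i + (f j + f k) ≤ sum f
three-entries≤sum f {i} {j} {k} i≢j i≢k j≢k = extract-≤ f i (subst₂ (λ x y → x + y ≤ sum (updateAt f i (const 0)))
  (updateAt-minimal j i f (i≢j ∘ sym)) (updateAt-minimal k i f (i≢k ∘ sym)) (two-entries≤sum _ j≢k))

sum-lower : ∀ {n} m (f : Vector ℕ n) → (∀ i → m ≤ f i) → n * m ≤ sum f
sum-lower {zero}  m f m≤f = z≤n
sum-lower {suc n} m f m≤f = +-mono-≤ (m≤f zero) (sum-lower m (f ∘ suc) (m≤f ∘ suc))

sum-lower-strict : ∀ {n} m (f : Vector ℕ n) → (∀ i → m ≤ f i) → ∀ i → m < f i → n * m < sum f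
sum-lower-strict m f m≤f zero    m<fi = +-mono-<-≤ m<fi (sum-lower m (f ∘ suc) (m≤f ∘ suc))
sum-lower-strict m f m≤f (suc i) m<fi = +-mono-≤-< (m≤f zero) (sum-lower-strict m (f ∘ suc) (m≤f ∘ suc) i m<fi)

-- Sides of the bipartition and choice of fresh vertices

side : ∀ n₁ {n₂} → Fin (n₁ + n₂) → Bool
side n₁ i = toℕ i <ᵇ n₁

side-↑ˡ : ∀ {n₁} n₂ (i : Fin n₁) → side n₁ (i ↑ˡ n₂) ≡ true
side-↑ˡ n₂ i rewrite toℕ-↑ˡ i n₂ = T⇒≡true (<⇒<ᵇ (toℕ<n i))

side-↑ʳ : ∀ n₁ {n₂} (i : Fin n₂) → side n₁ (n₁ ↑ʳ i) ≡ false
side-↑ʳ n₁ i rewrite toℕ-↑ʳ n₁ i = ¬-not (λ e → m+n≮m n₁ (toℕ i) (<ᵇ⇒< _ _ (≡true⇒T e)))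

xor-true⁻ : ∀ {x y} → x xor y ≡ true → x ≢ y
xor-true⁻ {true}  {true}  () refl
xor-true⁻ {false} {false} () refl

xor-true⁺ : ∀ {x y} → x ≢ y → x xor y ≡ true
xor-true⁺ {true}  {true}  e = contradiction refl e
xor-true⁺ {true}  {false} e = refl
xor-true⁺ {false} {true}  e = refl
xor-true⁺ {false} {false} e = contradiction refl e

≢-≢⇒≡ : ∀ {x y z : Bool} → x ≢ y → y ≢ z → x ≡ z
≢-≢⇒≡ p q = trans (¬-not p) (sym (¬-not (q ∘ sym)))

-- If every `f i` occurred in `xs`, two indices would share a place there, against injectivity of
-- `f`.
avoid : ∀ {a m n} {A : Set a} (_≟ᴬ_ : ∀ (x y : A) → Dec (x ≡ y)) (f : Fin m → A) → Injective _≡_ _≡_ f → n < m →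
        (xs : Vector A n) → ∃ λ i → ∀ j → f i ≢ xs j
avoid {m = m} _≟ᴬ_ f f-injective n<m xs
  with i , ∄ ← ¬∀⟶∃¬ m (λ i → ∃ λ j → f i ≡ xs j) (λ i → any? (λ j → f i ≟ᴬ xs j)) (λ hit →
         let k , l , k<l , e = pigeonhole n<m (proj₁ ∘ hit)
         in <⇒≢ k<l (f-injective (trans (proj₂ (hit k)) (trans (cong xs e) (sym (proj₂ (hit l)))))))
  = i , λ j e → ∄ (j , e)

triple-injective : ∀ {a} {A : Set a} {x y z : A} → x ≢ y → x ≢ z → y ≢ z →
                   Injective _≡_ _≡_ (x ∷ y ∷ z ∷ [])
triple-injective x≢y x≢z y≢z {0F} {0F} e = refl
triple-injective x≢y x≢z y≢z {0F} {1F} e = contradiction e x≢y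
triple-injective x≢y x≢z y≢z {0F} {2F} e = contradiction e x≢z
triple-injective x≢y x≢z y≢z {1F} {0F} e = contradiction (sym e) x≢y
triple-injective x≢y x≢z y≢z {1F} {1F} e = refl
triple-injective x≢y x≢z y≢z {1F} {2F} e = contradiction e y≢z
triple-injective x≢y x≢z y≢z {2F} {0F} e = contradiction (sym e) x≢z
triple-injective x≢y x≢z y≢z {2F} {1F} e = contradiction (sym e) y≢z
triple-injective x≢y x≢z y≢z {2F} {2F} e = refl

-- Hexagons

rot : Fin 6 → Fin 6
rot 0F = 1F
rot 1F = 2F
rot 2F = 3F
rot 3F = 4F
rot 4F = 5F
rot 5F = 0F

rot-injective : Injective _≡_ _≡_ rot
rot-injective {i} {j} = from-yes (all? λ i → all? λ j → rot i ≟ rot j →-dec i ≟ j) i j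

Next-rot : ∀ i → Next i (rot i)
Next-rot 0F = inj₁ refl
Next-rot 1F = inj₁ refl
Next-rot 2F = inj₁ refl
Next-rot 3F = inj₁ refl
Next-rot 4F = inj₁ refl
Next-rot 5F = inj₂ (refl , refl)

Next⇒rot : ∀ {i j} → Next i j → j ≡ rot i
Next⇒rot {0F} (inj₁ e) = toℕ-injective e
Next⇒rot {1F} (inj₁ e) = toℕ-injective e
Next⇒rot {2F} (inj₁ e) = toℕ-injective e
Next⇒rot {3F} (inj₁ e) = toℕ-injective e
Next⇒rot {4F} (inj₁ e) = toℕ-injective e
Next⇒rot {5F} {j} (inj₁ e) = contradiction (subst (_< 6) e (toℕ<n j)) (<-irrefl refl)
Next⇒rot {i} {j} (inj₂ (e , e′)) rewrite toℕ-injective {i = i} {5F} (suc-injective e) = toℕ-injective e′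

module _ {n} (A : Adj n) where

  Hexagon : (Fin 6 → Fin n) → Set
  Hexagon φ = Injective _≡_ _≡_ φ × (∀ k → A (φ k) (φ (rot k)) ≡ true)

  hexagon : ((φ , _) : ContainsCopy A (C 6)) → Hexagon φ
  hexagon (φ , φ-injective , φ-edge) = φ-injective , λ k → φ-edge k (rot k) (Next⇒C (Next-rot k))

  hexagon⁻¹ : (∀ i j → A i j ≡ A j i) → ∀ {φ} → Hexagon φ → ContainsCopy A (C 6)
  hexagon⁻¹ A-sym {φ} (φ-injective , φ-edge) = φ , φ-injective ,
    C-elim (λ i j → A (φ i) (φ j) ≡ true) (trans (A-sym _ _))
           (λ {i} step → subst (λ j → A (φ i) (φ j) ≡ true) (sym (Next⇒rot step)) (φ-edge i))

  hexagon-rot : ∀ {φ} → Hexagon φ → Hexagon (φ ∘ rot)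
  hexagon-rot (φ-injective , φ-edge) = rot-injective ∘ φ-injective , φ-edge ∘ rot

-- Lower bound for C₆: paths of length 5 in a saturated graph

module Saturated {n₁ n₂} (H : Adj (n₁ + n₂)) (saturated : IsSaturated (K n₁ n₂) (C 6) H)
                 (5≤n₁ : 5 ≤ n₁) (5≤n₂ : 5 ≤ n₂) where

  V : Set
  V = Fin (n₁ + n₂)

  infix 4 _~_ _≁_ _∥_

  _~_ _≁_ _∥_ : V → V → Set
  i ~ j = H i j ≡ true
  i ≁ j = ¬ i ~ j
  i ∥ j = side n₁ i ≡ side n₁ j

  _~?_ : ∀ i j → Dec (i ~ j)
  i ~? j = H i j Bool.≟ true

  H-sym : ∀ i j → H i j ≡ H j i
  H-sym = proj₁ (proj₁ (proj₁ saturated))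

  ~-sym : ∀ {i j} → i ~ j → j ~ i
  ~-sym = trans (H-sym _ _)

  ~⇒∦ : ∀ {i j} → i ~ j → ¬ i ∥ j
  ~⇒∦ e = xor-true⁻ (proj₂ (proj₁ saturated) _ _ e)

  ~⇒≢ : ∀ {i j} → i ~ j → i ≢ j
  ~⇒≢ e refl = ~⇒∦ e refl

  ~-~⇒∥ : ∀ {i j k} → i ~ j → j ~ k → i ∥ k
  ~-~⇒∥ p q = ≢-≢⇒≡ (~⇒∦ p) (~⇒∦ q)

  ~-~-~⇒∦ : ∀ {i j k l} → i ~ j → j ~ k → k ~ l → ¬ i ∥ l
  ~-~-~⇒∦ p q r e = ~⇒∦ r (trans (sym (~-~⇒∥ p q)) e)

  module _ {x b c d y z} (x~b : x ~ b) (b~c : b ~ c) (c~d : c ~ d) (d~y : d ~ y) (y~z : y ~ z) (z~x : z ~ x) where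

    -- The bipartition separates `x`, `c`, `y` from `b`, `d`, `z`, so distinctness is asked only
    -- within each triple.
    no-hexagon : x ≢ c → x ≢ y → c ≢ y → b ≢ d → b ≢ z → d ≢ z → ⊥
    no-hexagon x≢c x≢y c≢y b≢d b≢z d≢z = proj₁ (proj₂ saturated)
      (alternating-cycle H H-sym s t (triple-injective x≢c x≢y c≢y) (triple-injective b≢d b≢z d≢z) s≢t s~t t~s)
      where
      s t : Vector V 3
      s = x ∷ c ∷ y ∷ []
      t = b ∷ d ∷ z ∷ []

      s∥x : ∀ i → s i ∥ x
      s∥x 0F = refl
      s∥x 1F = sym (~-~⇒∥ x~b b~c)
      s∥x 2F = ~-~⇒∥ y~z z~x

      t∦x : ∀ j → ¬ t j ∥ x
      t∦x 0F = ~⇒∦ (~-sym x~b)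
      t∦x 1F = ~-~-~⇒∦ d~y y~z z~x
      t∦x 2F = ~⇒∦ z~x

      s≢t : ∀ i j → s i ≢ t j
      s≢t i j e = t∦x j (subst (_∥ x) e (s∥x i))

      s~t : ∀ i → s i ~ t i
      s~t 0F = x~b
      s~t 1F = c~d
      s~t 2F = y~z

      t~s : ∀ {i j} → Next i j → t i ~ s j
      t~s {0F} {1F} _ = b~c
      t~s {1F} {2F} _ = d~y
      t~s {2F} {0F} _ = z~x
      t~s {0F} {0F} (inj₁ ())
      t~s {0F} {0F} (inj₂ (() , _))
      t~s {0F} {2F} (inj₁ ())
      t~s {0F} {2F} (inj₂ (() , _))
      t~s {1F} {0F} (inj₁ ())
      t~s {1F} {0F} (inj₂ (() , _))
      t~s {1F} {1F} (inj₁ ())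
      t~s {1F} {1F} (inj₂ (() , _))
      t~s {2F} {1F} (inj₁ ())
      t~s {2F} {1F} (inj₂ (_ , ()))
      t~s {2F} {2F} (inj₁ ())
      t~s {2F} {2F} (inj₂ (_ , ()))

  -- A path of length 5. Here too `u`, `b`, `d` and `a`, `c`, `v` lie on opposite sides.
  record Path (u v : V) : Set where
    constructor path
    field
      {a b c d} : V
      u~a : u ~ a
      a~b : a ~ b
      b~c : b ~ c
      c~d : c ~ d
      d~v : d ~ v
      u≢b : u ≢ b
      u≢d : u ≢ d
      b≢d : b ≢ d
      a≢c : a ≢ c
      a≢v : a ≢ v
      c≢v : c ≢ v

  reverse : ∀ {u v} → Path u v → Path v u
  reverse (path u~a a~b b~c c~d d~v u≢b u≢d b≢d a≢c a≢v c≢v) =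
    path (~-sym d~v) (~-sym c~d) (~-sym b~c) (~-sym a~b) (~-sym u~a)
         (c≢v ∘ sym) (a≢v ∘ sym) (a≢c ∘ sym) (b≢d ∘ sym) (u≢d ∘ sym) (u≢b ∘ sym)

  module _ {u v : V} where

    private
      H+uv = addEdge H u v

    -- Without the edge from `φ 0F` to `φ 1F` the hexagon is a path of length 5, and by injectivity
    -- no other edge of it can be the added one. The names `x`, `y` allow for both orientations of
    -- that edge.
    open-hexagon : ∀ {φ x y} → Hexagon H+uv φ →
                   (∀ {i j} → H+uv i j ≡ true → i ~ j ⊎ (i ≡ x × j ≡ y) ⊎ (i ≡ y × j ≡ x)) →
                   φ 0F ≡ x → φ 1F ≡ y → Path x y
    open-hexagon {φ} (φ-injective , φ-edge) edge refl refl =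
      path (~-sym (old 5F λ ())) (~-sym (old 4F λ ())) (~-sym (old 3F λ ())) (~-sym (old 2F λ ())) (~-sym (old 1F λ ()))
           (φ-≢ (λ ())) (φ-≢ (λ ())) (φ-≢ (λ ())) (φ-≢ (λ ())) (φ-≢ (λ ())) (φ-≢ (λ ()))
      where
      φ-≢ : ∀ {i j} → i ≢ j → φ i ≢ φ j
      φ-≢ i≢j e = i≢j (φ-injective e)

      old : ∀ k → k ≢ 0F → φ k ~ φ (rot k)
      old k k≢0 with edge (φ-edge k)
      ... | inj₁ h = h
      ... | inj₂ (inj₁ (e , _)) = contradiction (φ-injective e) k≢0
      ... | inj₂ (inj₂ (e , e′)) with refl ← φ-injective e = contradiction (φ-injective e′) (λ ())

    long-path : ¬ u ∥ v → u ≁ v → Path u v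
    long-path u∦v u≁v = search 6 (hexagon H+uv copy)
      (λ i 6≤i → contradiction (toℕ<n i) (≤⇒≯ 6≤i))
      where
      copy : ContainsCopy H+uv (C 6)
      copy = proj₂ (proj₂ saturated) u v (xor-true⁺ u∦v) (¬-not u≁v)

      is-old? : ∀ {i j} → H+uv i j ≡ true → i ~ j ⊎ (i ≡ u × j ≡ v) ⊎ (i ≡ v × j ≡ u)
      is-old? = addEdge⁻ H u v

      -- The hexagon is rotated until the added edge comes first. Edges from position `m` on are
      -- known to be old; at `m = 0` all six are, and `H` would contain a hexagon.
      search : ∀ m {φ} → Hexagon H+uv φ → (∀ i → m ≤ toℕ i → φ i ~ φ (rot i)) → Path u v
      search zero hex@(φ-injective , _) old =
        contradiction (hexagon⁻¹ H H-sym (φ-injective , λ k → old k z≤n)) (proj₁ (proj₂ saturated))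
      search (suc m) {φ} hex old with is-old? (proj₂ hex 0F)
      ... | inj₂ (inj₁ (e , e′)) = open-hexagon hex is-old? e e′
      ... | inj₂ (inj₂ (e , e′)) = reverse (open-hexagon hex ([ inj₁ , inj₂ ∘ swap ]′ ∘ is-old?) e e′)
      ... | inj₁ h = search m (hexagon-rot H+uv hex) old-rot
        where
        old-rot : ∀ i → m ≤ toℕ i → φ (rot i) ~ φ (rot (rot i))
        old-rot i m≤i with Next-rot i
        ... | inj₁ e       = old (rot i) (subst (suc m ≤_) (sym e) (s≤s m≤i))
        ... | inj₂ (_ , e) = subst (λ k → φ k ~ φ (rot k)) (sym (toℕ-injective e)) h

  on : Bool → Fin 5 → V
  on true  k = inject≤ k 5≤n₁ ↑ˡ n₂
  on false k = n₁ ↑ʳ inject≤ k 5≤n₂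

  side-on : ∀ b k → side n₁ (on b k) ≡ b
  side-on true  k = side-↑ˡ {n₁} n₂ (inject≤ k 5≤n₁)
  side-on false k = side-↑ʳ n₁ (inject≤ k 5≤n₂)

  on-injective : ∀ b → Injective _≡_ _≡_ (on b)
  on-injective true  e = inject≤-injective _ _ _ _ (↑ˡ-injective n₂ _ _ e)
  on-injective false e = inject≤-injective _ _ _ _ (↑ʳ-injective n₁ _ _ e)

  opposite-of : ∀ i → ∃ λ u → ¬ i ∥ u
  opposite-of i = on (not (side n₁ i)) 0F , λ e → not-¬ refl (trans e (side-on (not (side n₁ i)) 0F))

  -- Here the bound 5 on both sides enters: four is the number of vertices of a C₄, and of a C₈ on
  -- one side.
  avoiding : ∀ i (xs : Vector V 4) → ∃ λ u → u ∥ i × (∀ k → u ≢ xs k)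
  avoiding i xs with k , k∉ ← avoid _≟_ (on (side n₁ i)) (on-injective (side n₁ i)) ≤-refl xs
    = on (side n₁ i) k , side-on (side n₁ i) k , k∉

  -- Leaves and hanging trees

  neighbour : ∀ i → ∃ λ j → i ~ j
  neighbour i with u , i∦u ← opposite-of i with i ~? u
  ... | yes i~u = u , i~u
  ... | no  i≁u = _ , Path.u~a (long-path i∦u i≁u)

  -- Degree at least two. By `neighbour`, a vertex without this property is a leaf.
  Fork : V → Set
  Fork i = ∃₂ λ j k → i ~ j × i ~ k × j ≢ k

  Fork? : ∀ i → Dec (Fork i)
  Fork? i = any? λ j → any? λ k → i ~? j ×-dec i ~? k ×-dec ¬? (j ≟ k)

  ¬Fork⇒≡ : ∀ {i j k} → ¬ Fork i → i ~ j → i ~ k → j ≡ k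
  ¬Fork⇒≡ ¬fork i~j i~k = decidable-stable (_ ≟ _) λ j≢k → ¬fork (_ , _ , i~j , i~k , j≢k)

  fork-avoiding : ∀ {i} j → Fork i → ∃ λ k → i ~ k × k ≢ j
  fork-avoiding j (k , l , i~k , i~l , k≢l) with k ≟ j
  ... | yes refl = l , i~l , k≢l ∘ sym
  ... | no  k≢j  = k , i~k , k≢j

  -- For an edge i ~ j, Onward i j fails iff i and its neighbours other than j form a tree hanging off j.
  Onward : V → V → Set
  Onward i j = ∃ λ k → i ~ k × k ≢ j × Fork k

  Onward? : ∀ i j → Dec (Onward i j)
  Onward? i j = any? λ k → i ~? k ×-dec ¬? (k ≟ j) ×-dec Fork? k

  via : ∀ {i j k l m} → i ~ k → k ≢ j → k ~ l → k ~ m → l ≢ m → Onward i j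
  via i~k k≢j k~l k~m l≢m = _ , i~k , k≢j , _ , _ , k~l , k~m , l≢m

  -- If all neighbours of `i` were leaves, a path of length 5 from such a leaf `w` to another vertex
  -- on the side of `i` would start `w`, `i`, `b`; but `b` has the two neighbours `i` and `c`.
  fork-neighbour : ∀ i → ∃ λ j → i ~ j × Fork j
  fork-neighbour i with any? (λ j → i ~? j ×-dec Fork? j)
  ... | yes p = p
  ... | no ¬fork
    with w , i~w ← neighbour i
    with u , u∥i , u≢i ← avoiding i (const i)
    with path w~a a~b b~c _ _ _ _ _ a≢c _ _ ← long-path {w} {u} (λ e → ~⇒∦ i~w (trans (sym u∥i) (sym e)))
           (λ w~u → u≢i 0F (¬Fork⇒≡ (λ f → ¬fork (w , i~w , f)) w~u (~-sym i~w)))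
    with refl ← ¬Fork⇒≡ (λ f → ¬fork (w , i~w , f)) w~a (~-sym i~w)
    = contradiction (_ , a~b , _ , _ , ~-sym a~b , b~c , a≢c) ¬fork

  -- 4-cycles forced by leaves and hanging trees

  record Square (p q r s : V) : Set where
    constructor square
    field
      p~q : p ~ q
      q~r : q ~ r
      r~s : r ~ s
      s~p : s ~ p
      p≢r : p ≢ r
      q≢s : q ≢ s

  square-rot : ∀ {p q r s} → Square p q r s → Square q r s p
  square-rot (square p~q q~r r~s s~p p≢r q≢s) = square q~r r~s s~p p~q q≢s (p≢r ∘ sym)

  square-flip : ∀ {p q r s} → Square p q r s → Square p s r q
  square-flip (square p~q q~r r~s s~p p≢r q≢s) =
    square (~-sym s~p) (~-sym r~s) (~-sym q~r) (~-sym p~q) p≢r (q≢s ∘ sym)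

  -- The witness is `s`, which is adjacent to `p` and `r`. Used in both directions, this makes all
  -- edges of a 4-cycle core edges.
  square-onward : ∀ {p q r s} → Square p q r s → Onward p q
  square-onward (square p~q q~r r~s s~p p≢r q≢s) = via (~-sym s~p) (q≢s ∘ sym) s~p (~-sym r~s) p≢r

  -- Let `w` be a neighbour of `i` other than `j`, necessarily a leaf. A path of length 5 from `w`
  -- to `y` starts `w`, `i`, `j`, since its third vertex is not a leaf; its remainder and the edge
  -- from `y` to `j` form the 4-cycle.
  hanging-square : ∀ {i j y} → i ~ j → Fork i → ¬ Onward i j → j ~ y → y ≢ i → ∃₂ λ b c → Square j b c y
  hanging-square {i} {j} {y} i~j fork ¬onward j~y y≢i
    with w , i~w , w≢j ← fork-avoiding j fork
    with leaf ← (λ f → ¬onward (w , i~w , w≢j , f))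
    with path {b = b} w~a a~b b~c c~d d~y w≢b _ b≢d a≢c _ c≢y ← long-path {w} {y} (~-~-~⇒∦ (~-sym i~w) i~j j~y)
           (λ w~y → y≢i (¬Fork⇒≡ leaf w~y (~-sym i~w)))
    with refl ← ¬Fork⇒≡ leaf w~a (~-sym i~w)
    with b ≟ j
  ... | no  b≢j  = contradiction (via a~b b≢j (~-sym a~b) b~c a≢c) ¬onward
  ... | yes refl = _ , _ , square b~c c~d d~y (~-sym j~y) b≢d c≢y

  -- Extend `w` to a path `w`, `x`, `z`, `y` and compare it with a path `w`, `x`, `b`, `c`, `d`,
  -- `y`. If `z` is `b` or `d`, a 4-cycle appears; otherwise `x`, `b`, `c`, `d`, `y`, `z` is a
  -- hexagon.
  leaf-square : ∀ {w} → ¬ Fork w → ∃₂ λ p q → ∃₂ λ r s → Square p q r s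
  leaf-square {w} leaf
    with x , w~x ← neighbour w
    with z , x~z , fork ← fork-neighbour x
    with y , z~y , y≢x ← fork-avoiding x fork
    with path {b = b} {d = d} w~a a~b b~c c~d d~y w≢b _ b≢d a≢c a≢y c≢y ← long-path {w} {y} (~-~-~⇒∦ w~x x~z z~y)
           (λ w~y → y≢x (¬Fork⇒≡ leaf w~y w~x))
    with refl ← ¬Fork⇒≡ leaf w~a w~x
    with b ≟ z | d ≟ z
  ... | yes refl | _        = _ , _ , _ , _ , square b~c c~d d~y (~-sym z~y) b≢d c≢y
  ... | no  b≢z  | yes refl = _ , _ , _ , _ , square a~b b~c c~d (~-sym x~z) a≢c b≢z
  ... | no  b≢z  | no  d≢z  = ⊥-elim
    (no-hexagon a~b b~c c~d d~y (~-sym z~y) (~-sym x~z) a≢c a≢y c≢y b≢d b≢z d≢z)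

  -- Neither end lies in a tree hanging off the other: such edges stand for the edges of the 2-core.
  CoreEdge : V → V → Set
  CoreEdge i j = i ~ j × Onward i j × Onward j i

  CoreEdge? : ∀ i j → Dec (CoreEdge i j)
  CoreEdge? i j = i ~? j ×-dec Onward? i j ×-dec Onward? j i

  CoreFork : V → Set
  CoreFork i = ∃₂ λ j k → CoreEdge i j × CoreEdge i k × j ≢ k

  -- `j` and its leaves hang off `i`, so `hanging-square` puts the edge from `i` to `y` on a
  -- 4-cycle, whose two edges at `i` are core edges.
  hanging-core-fork : ∀ {i j y} → (∀ {k} → i ~ k → Onward i k) →
                      i ~ j → Fork j → ¬ Onward j i → i ~ y → y ≢ j → CoreFork i
  hanging-core-fork onward i~j fork ¬onward i~y y≢j
    with b , c , sq ← hanging-square (~-sym i~j) fork ¬onward i~y y≢j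
    = b , _ , (Square.p~q sq , onward (Square.p~q sq) , square-onward (square-flip (square-rot sq)))
            , (i~y , onward i~y , square-onward (square-rot (square-rot (square-rot sq)))) , Square.q≢s sq

  -- There are two nonleaf neighbours `j` and `k`. If neither hangs off `i`, both edges are core
  -- edges; if one does, the other lies on a 4-cycle.
  core-fork : ∀ {i} → (∀ {k} → i ~ k → Onward i k) → CoreFork i
  core-fork {i} onward
    with j , i~j , fork-j ← fork-neighbour i
    with k , i~k , k≢j , fork-k ← onward i~j
    with Onward? j i | Onward? k i
  ... | no ¬o | _     = hanging-core-fork onward i~j fork-j ¬o i~k k≢j
  ... | yes _ | no ¬o = hanging-core-fork onward i~k fork-k ¬o i~j (k≢j ∘ sym)
  ... | yes o | yes o′ = j , k , (i~j , onward i~j , o) , (i~k , onward i~k , o′) , k≢j ∘ sym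

  Closed : (V → Set) → Set
  Closed S = ∀ {i j} → S i → i ~ j → S j

  -- A vertex on the other side is a neighbour or the end of a path of length 5, so it is reachable
  -- in any case.
  closed-opposite : ∀ {S i} u → Closed S → S i → ¬ i ∥ u → S u
  closed-opposite {i = i} u closed Si i∦u with i ~? u
  ... | yes i~u = closed Si i~u
  ... | no  i≁u with path u~a a~b b~c c~d d~v _ _ _ _ _ _ ← long-path i∦u i≁u
    = closed (closed (closed (closed (closed Si u~a) a~b) b~c) c~d) d~v

  -- Contradiction from a core without branching

  CoreBranch : Set
  CoreBranch = ∃ λ i → ∃ λ j → ∃ λ k → ∃ λ l →
    CoreEdge i j × CoreEdge i k × CoreEdge i l × j ≢ k × j ≢ l × k ≢ l

  module Unbranched (unbranched : ¬ CoreBranch) where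

    core-third : ∀ {i j k l} → CoreEdge i j → CoreEdge i k → j ≢ k → CoreEdge i l → l ≡ j ⊎ l ≡ k
    core-third {j = j} {k} {l} ij ik j≢k il with l ≟ j | l ≟ k
    ... | yes l≡j | _       = inj₁ l≡j
    ... | no _    | yes l≡k = inj₂ l≡k
    ... | no l≢j  | no l≢k  = contradiction (_ , _ , _ , _ , ij , ik , il , j≢k , l≢j ∘ sym , l≢k ∘ sym) unbranched

    square-core : ∀ {p q r s} → Square p q r s → CoreEdge p q
    square-core sq = Square.p~q sq , square-onward sq , square-onward (square-flip (square-rot sq))

    -- If `b` is not `q`, then `q` witnesses `Onward p b`, so `b` is a core neighbour of `p`, as `q`
    -- and `s` already are.
    square-onward-neighbour : ∀ {p q r s b} → Square p q r s → p ~ b → Onward b p → b ≡ q ⊎ b ≡ s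
    square-onward-neighbour {q = q} {b = b} sq@(square p~q q~r _ _ p≢r q≢s) p~b onward with b ≟ q
    ... | yes b≡q = inj₁ b≡q
    ... | no  b≢q = core-third (square-core sq) (square-core (square-flip sq)) q≢s
                      (p~b , via p~q (b≢q ∘ sym) (~-sym p~q) q~r p≢r , onward)

    -- If `w` hangs off `p`, take a path of length 5 from `w` to the opposite corner `r`. It starts
    -- `w`, `p`, and its vertices `b` and `d` are `q` and `s` in some order. Then `c` is adjacent to
    -- both, and `q` has the three core neighbours `p`, `r`, `c`.
    square-closed : ∀ {p q r s w} → Square p q r s → p ~ w → w ≡ q ⊎ w ≡ s
    square-closed {p} {q} {r} {s} {w} sq@(square p~q q~r r~s s~p p≢r q≢s) p~w
      with Onward? w p
    ... | yes onward = square-onward-neighbour sq p~w onward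
    ... | no ¬onward
      with path {a} {b} {c} {d} w~a a~b b~c c~d d~r w≢b _ b≢d a≢c _ c≢r
           ← long-path {w} {r} (~-~-~⇒∦ (~-sym p~w) p~q q~r)
             (λ w~r → ¬onward (via w~r (p≢r ∘ sym) (~-sym q~r) r~s q≢s))
      with a ≟ p
    ... | no  a≢p  = contradiction (via w~a a≢p (~-sym w~a) a~b w≢b) ¬onward
    ... | yes refl = ⊥-elim (third-neighbour
            (square-onward-neighbour sq a~b (via b~c (a≢c ∘ sym) (~-sym b~c) c~d b≢d))
            (square-onward-neighbour (square-rot (square-rot sq)) (~-sym d~r)
              (via (~-sym c~d) c≢r c~d (~-sym b~c) (b≢d ∘ sym))))
      where
      crossing : c ~ q → c ~ s → ⊥
      crossing c~q c~s = [ a≢c ∘ sym , c≢r ]′ (core-third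
        (square-core (square-flip (square-rot sq))) (square-core (square-rot sq)) p≢r
        (~-sym c~q , via (~-sym p~q) a≢c p~q (~-sym s~p) q≢s , via c~s (q≢s ∘ sym) (~-sym c~s) s~p (a≢c ∘ sym)))

      third-neighbour : b ≡ q ⊎ b ≡ s → d ≡ s ⊎ d ≡ q → ⊥
      third-neighbour (inj₁ refl) (inj₁ refl) = crossing (~-sym b~c) c~d
      third-neighbour (inj₂ refl) (inj₂ refl) = crossing c~d (~-sym b~c)
      third-neighbour (inj₁ refl) (inj₂ refl) = b≢d refl
      third-neighbour (inj₂ refl) (inj₁ refl) = b≢d refl

    _∈ᵛ_ : ∀ {n} → V → Vector V n → Set
    x ∈ᵛ xs = ∃ λ k → x ≡ xs k

    one-of : ∀ {n} (xs : Vector V n) j k {x} → x ≡ xs j ⊎ x ≡ xs k → x ∈ᵛ xs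
    one-of xs j k (inj₁ e) = j , e
    one-of xs j k (inj₂ e) = k , e

    vertices : V → V → V → V → Vector V 4
    vertices p q r s = p ∷ q ∷ r ∷ s ∷ []

    square-component : ∀ {p q r s} → Square p q r s → Closed (_∈ᵛ vertices p q r s)
    square-component sq (0F , refl) e = one-of (vertices _ _ _ _) 1F 3F (square-closed sq e)
    square-component sq (1F , refl) e = one-of (vertices _ _ _ _) 2F 0F (square-closed (square-rot sq) e)
    square-component sq (2F , refl) e = one-of (vertices _ _ _ _) 3F 1F (square-closed (square-rot (square-rot sq)) e)
    square-component sq (3F , refl) e =
      one-of (vertices _ _ _ _) 0F 2F (square-closed (square-rot (square-rot (square-rot sq))) e)

    -- Being closed under adjacency, the 4-cycle would contain the whole side of `p`.
    no-square : ∀ {p q r s} → ¬ Square p q r s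
    no-square {p} {q} {r} {s} sq =
      let u , u∥p , u∉S = avoiding p (vertices p q r s)
      in uncurry u∉S (closed-opposite {_∈ᵛ vertices p q r s} u (square-component sq) (1F , refl)
           (λ e → ~⇒∦ (Square.p~q sq) (trans (sym u∥p) (sym e))))

    abstract
      fork : ∀ i → Fork i
      fork i = decidable-stable (Fork? i) λ leaf → let _ , _ , _ , _ , sq = leaf-square leaf in no-square sq

    onward : ∀ i j → Onward i j
    onward i j = let k , i~k , k≢j = fork-avoiding j (fork i) in k , i~k , k≢j , fork k

    -- Without 4-cycles there are no leaves, so all edges are core edges and, by `third`, all
    -- degrees are two.
    core-edge : ∀ {i j} → i ~ j → CoreEdge i j
    core-edge i~j = i~j , onward _ _ , onward _ _

    abstract
      third : ∀ {i j k l} → i ~ j → i ~ k → j ≢ k → i ~ l → l ≡ j ⊎ l ≡ k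
      third i~j i~k j≢k i~l = core-third (core-edge i~j) (core-edge i~k) j≢k (core-edge i~l)

    module Octagon {v₀ v₁ v₂ v₃ v₄ v₅ v₆ v₇}
      (e₀ : v₀ ~ v₁) (e₁ : v₁ ~ v₂) (e₂ : v₂ ~ v₃) (e₃ : v₃ ~ v₄)
      (e₄ : v₄ ~ v₅) (e₅ : v₅ ~ v₆) (e₆ : v₆ ~ v₇) (e₇ : v₇ ~ v₀)
      (v₀≢v₂ : v₀ ≢ v₂) (v₁≢v₃ : v₁ ≢ v₃) (v₂≢v₄ : v₂ ≢ v₄) (v₃≢v₅ : v₃ ≢ v₅)
      (v₄≢v₆ : v₄ ≢ v₆) (v₅≢v₇ : v₅ ≢ v₇) (v₆≢v₀ : v₆ ≢ v₀) (v₇≢v₁ : v₇ ≢ v₁) where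

      evens odds : Vector V 4
      evens = v₀ ∷ v₂ ∷ v₄ ∷ v₆ ∷ []
      odds  = v₁ ∷ v₃ ∷ v₅ ∷ v₇ ∷ []

      Vertex : V → Set
      Vertex x = x ∈ᵛ evens ⊎ x ∈ᵛ odds

      component : Closed Vertex
      component (inj₁ (0F , refl)) e = inj₂ (one-of odds 3F 0F (third (~-sym e₇) e₀ v₇≢v₁ e))
      component (inj₁ (1F , refl)) e = inj₂ (one-of odds 0F 1F (third (~-sym e₁) e₂ v₁≢v₃ e))
      component (inj₁ (2F , refl)) e = inj₂ (one-of odds 1F 2F (third (~-sym e₃) e₄ v₃≢v₅ e))
      component (inj₁ (3F , refl)) e = inj₂ (one-of odds 2F 3F (third (~-sym e₅) e₆ v₅≢v₇ e))
      component (inj₂ (0F , refl)) e = inj₁ (one-of evens 0F 1F (third (~-sym e₀) e₁ v₀≢v₂ e))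
      component (inj₂ (1F , refl)) e = inj₁ (one-of evens 1F 2F (third (~-sym e₂) e₃ v₂≢v₄ e))
      component (inj₂ (2F , refl)) e = inj₁ (one-of evens 2F 3F (third (~-sym e₄) e₅ v₄≢v₆ e))
      component (inj₂ (3F , refl)) e = inj₁ (one-of evens 3F 0F (third (~-sym e₆) e₇ v₆≢v₀ e))

      odds∦v₀ : ∀ k → ¬ odds k ∥ v₀
      odds∦v₀ 0F = ~⇒∦ (~-sym e₀)
      odds∦v₀ 1F = ~-~-~⇒∦ (~-sym e₂) (~-sym e₁) (~-sym e₀)
      odds∦v₀ 2F = ~-~-~⇒∦ e₅ e₆ e₇
      odds∦v₀ 3F = ~⇒∦ e₇

      -- The closed walk of length 8 uses up both edges at each of its vertices, so it would contain
      -- the whole side of `v₀`. Only `evens` are on that side, and a fifth vertex avoids them.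
      absurd : ⊥
      absurd =
        let u , u∥v₀ , u∉ = avoiding v₀ evens
        in [ uncurry u∉ , (λ (k , e) → odds∦v₀ k (trans (cong (side n₁) (sym e)) u∥v₀)) ]′
             (closed-opposite {Vertex} u component (inj₂ (0F , refl)) (λ e → ~⇒∦ e₀ (trans (sym u∥v₀) (sym e))))

    -- If `a` were `v₁`, degree two would force `b` to be `v₂` and then `c` to be `v₃`.
    path-tight : ∀ {v₀ v₁ v₂ v₃ a b c} → v₀ ~ v₁ → v₁ ~ v₂ → v₂ ~ v₃ → v₀ ≢ v₂ → v₁ ≢ v₃ →
                 a ~ b → b ~ c → v₀ ≢ b → a ≢ c → c ≢ v₃ → a ≢ v₁
    path-tight e₀ e₁ e₂ v₀≢v₂ v₁≢v₃ a~b b~c v₀≢b a≢c c≢v₃ refl with third (~-sym e₀) e₁ v₀≢v₂ a~b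
    ... | inj₁ b≡v₀ = v₀≢b (sym b≡v₀)
    ... | inj₂ refl = [ a≢c ∘ sym , c≢v₃ ]′ (third (~-sym e₁) e₂ v₁≢v₃ b~c)

    -- The two paths close up to `v₀`, `v₁`, `v₂`, `v₃`, `d`, `c`, `b`, `a`; `path-tight` from
    -- either end shows that this walk does not turn back at `v₀` or `v₃`.
    no-long-path : ∀ {v₀ v₁ v₂ v₃} → v₀ ~ v₁ → v₁ ~ v₂ → v₂ ~ v₃ → v₀ ≢ v₂ → v₁ ≢ v₃ → ¬ Path v₀ v₃
    no-long-path e₀ e₁ e₂ v₀≢v₂ v₁≢v₃ (path v₀~a a~b b~c c~d d~v₃ v₀≢b _ b≢d a≢c _ c≢v₃) =
      Octagon.absurd e₀ e₁ e₂ (~-sym d~v₃) (~-sym c~d) (~-sym b~c) (~-sym a~b) (~-sym v₀~a)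
        v₀≢v₂ v₁≢v₃
        (path-tight (~-sym e₂) (~-sym e₁) (~-sym e₀) (v₁≢v₃ ∘ sym) (v₀≢v₂ ∘ sym)
           (~-sym c~d) (~-sym b~c) (c≢v₃ ∘ sym) (b≢d ∘ sym) (v₀≢b ∘ sym) ∘ sym)
        (c≢v₃ ∘ sym) (b≢d ∘ sym) (a≢c ∘ sym) (v₀≢b ∘ sym)
        (path-tight e₀ e₁ e₂ v₀≢v₂ v₁≢v₃ a~b b~c v₀≢b a≢c c≢v₃)

    impossible : V → ⊥
    impossible v₀
      with v₁ , e₀₁ ← neighbour v₀
      with v₂ , e₁₂ , v₂≢v₀ ← fork-avoiding v₀ (fork v₁)
      with v₃ , e₂₃ , v₃≢v₁ ← fork-avoiding v₁ (fork v₂)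
      with v₀ ~? v₃
    ... | yes e₀₃ = no-square (square e₀₁ e₁₂ e₂₃ (~-sym e₀₃) (v₂≢v₀ ∘ sym) (v₃≢v₁ ∘ sym))
    ... | no ¬e₀₃ = no-long-path e₀₁ e₁₂ e₂₃ (v₂≢v₀ ∘ sym) (v₃≢v₁ ∘ sym) (long-path (~-~-~⇒∦ e₀₁ e₁₂ e₂₃) ¬e₀₃)

  core-branch : V → CoreBranch
  core-branch v = decidable-stable
    (any? λ i → any? λ j → any? λ k → any? λ l → CoreEdge? i j ×-dec CoreEdge? i k ×-dec CoreEdge? i l
      ×-dec ¬? (j ≟ k) ×-dec ¬? (j ≟ l) ×-dec ¬? (k ≟ l))
    λ ¬b → Unbranched.impossible ¬b v

  -- Discharging

  weight : V → V → ℕ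
  weight i j with Onward? i j | Onward? j i
  -- `weight i j` is the share of `i`, which takes everything when it hangs off `j`.
  ... | no _  | _     = 2
  ... | yes _ | no _  = 0
  ... | yes _ | yes _ = 1

  -- `j` has a nonleaf neighbour. If that is `i`, then the nonleaf neighbour of `i` must be `j`, and
  -- `hanging-square` puts another neighbour `y` of `j` on a 4-cycle, so `y` is no leaf.
  onward-or-onward : ∀ {i j} → i ~ j → ¬ Onward i j → Onward j i
  onward-or-onward {i} {j} i~j ¬onward with k , j~k , fork-k ← fork-neighbour j with k ≟ i
  ... | no  k≢i  = k , j~k , k≢i , fork-k
  ... | yes refl with l , i~l , fork-l ← fork-neighbour k with l ≟ j
  ...   | no  l≢j  = contradiction (l , i~l , l≢j , fork-l) ¬onward
  ...   | yes refl
        = let y , j~y , y≢i = fork-avoiding k fork-l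
              _ , _ , sq = hanging-square i~j fork-k ¬onward j~y y≢i
          in via j~y y≢i (Square.s~p sq) (~-sym (Square.r~s sq)) (Square.p≢r sq)

  charge : V → V → ℕ
  charge i j = if H i j then weight i j else 0

  edge : V → V → ℕ
  edge = edgeIndicator H

  weight-pair : ∀ {i j} → i ~ j → weight i j + weight j i ≤ 2
  weight-pair {i} {j} i~j with Onward? i j | Onward? j i
  ... | no ¬o | no ¬o′ = contradiction (onward-or-onward i~j ¬o) ¬o′
  ... | no _  | yes _  = ≤-refl
  ... | yes _ | no _   = ≤-refl
  ... | yes _ | yes _  = ≤-refl

  charge-~ : ∀ {i j} → i ~ j → charge i j ≡ weight i j
  charge-~ i~j rewrite i~j = refl

  charge-hanging : ∀ {i j} → i ~ j → ¬ Onward i j → charge i j ≡ 2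
  charge-hanging {i} {j} i~j ¬onward rewrite i~j with Onward? i j
  ... | yes o = contradiction o ¬onward
  ... | no _  = refl

  charge-core : ∀ {i j} → CoreEdge i j → charge i j ≡ 1
  charge-core {i} {j} (i~j , o , o′) rewrite i~j with Onward? i j | Onward? j i
  ... | no ¬o | _      = contradiction o ¬o
  ... | yes _ | no ¬o′ = contradiction o′ ¬o′
  ... | yes _ | yes _  = refl

  1≤edge-pair : ∀ {i j} → i ~ j → 1 ≤ edge i j + edge j i
  1≤edge-pair {i} {j} i~j with <-cmp (toℕ i) (toℕ j)
  ... | tri< i<j _ _ rewrite T⇒≡true (<⇒<ᵇ i<j) | i~j = s≤s z≤n
  ... | tri≈ _ i≡j _ = contradiction (toℕ-injective i≡j) (~⇒≢ i~j)
  ... | tri> _ _ j<i rewrite T⇒≡true (<⇒<ᵇ j<i) | ~-sym i~j = m≤n+m 1 (edge i j)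

  charge-pair : ∀ i j → charge i j + charge j i ≤ (edge i j + edge i j) + (edge j i + edge j i)
  charge-pair i j with i ~? j
  ... | no  i≁j rewrite ¬-not (i≁j ∘ ~-sym) | ¬-not i≁j = z≤n
  ... | yes i~j = begin
    charge i j + charge j i                                  ≡⟨ cong₂ _+_ (charge-~ i~j) (charge-~ (~-sym i~j)) ⟩
    weight i j + weight j i                                  ≤⟨ weight-pair i~j ⟩
    1 + 1                                                    ≤⟨ +-mono-≤ (1≤edge-pair i~j) (1≤edge-pair i~j) ⟩
    (edge i j + edge j i) + (edge i j + edge j i)    ≡⟨ interchange (edge i j) (edge j i) (edge i j) (edge j i) ⟩
    (edge i j + edge i j) + (edge j i + edge j i)            ∎
    where open ≤-Reasoning

  total : (V → V → ℕ) → ℕ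
  total f = sum λ i → sum (f i)

  total-+ : ∀ f g → total (λ i j → f i j + g i j) ≡ total f + total g
  total-+ f g = trans (sum-cong-≗ (λ i → ∑-distrib-+ (f i) (g i))) (∑-distrib-+ (sum ∘ f) (sum ∘ g))

  total-transpose : ∀ f → total (λ i j → f j i) ≡ total f
  total-transpose f = ∑-comm (λ i j → f j i)

  -- `edge` counts a pair in increasing order only, while both orders carry charge. Adding the
  -- transposed sums removes the asymmetry at the cost of a factor 2, which is cancelled.
  total-charge≤ : total charge ≤ edgeCount H + edgeCount H
  total-charge≤ = *-cancelˡ-≤ 2 (begin
    2 * total charge                                        ≡⟨ cong (total charge +_) (+-identityʳ _) ⟩
    total charge + total charge                             ≡⟨ cong (total charge +_) (total-transpose charge) ⟨
    total charge + total (λ i j → charge j i)               ≡⟨ total-+ charge (λ i j → charge j i) ⟨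
    total (λ i j → charge i j + charge j i)                 ≤⟨ sum-mono-≤ (λ i → sum-mono-≤ (charge-pair i)) ⟩
    total (λ i j → double i j + double j i)                 ≡⟨ total-+ double (λ i j → double j i) ⟩
    total double + total (λ i j → double j i)               ≡⟨ cong (total double +_) (total-transpose double) ⟩
    total double + total double                             ≡⟨ cong (total double +_) (+-identityʳ _) ⟨
    2 * total double                                        ≡⟨ cong (2 *_) (total-+ edge edge) ⟩
    2 * (total edge + total edge)                           ≡⟨ cong (λ k → 2 * (k + k)) (edgeCount≡∑ H) ⟨
    2 * (edgeCount H + edgeCount H)                         ∎)
    where
    open ≤-Reasoning
    double : V → V → ℕ
    double i j = edge i j + edge i j

  -- A vertex hanging off a neighbour gets 2 from that edge; any other has two core edges giving 1
  -- each.
  2≤charge : ∀ i → 2 ≤ sum (charge i)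
  2≤charge i with any? (λ j → i ~? j ×-dec ¬? (Onward? i j))
  ... | yes (j , i~j , ¬onward) = subst (_≤ sum (charge i)) (charge-hanging i~j ¬onward) (entry≤sum (charge i) j)
  ... | no none =
    let j , k , ij , ik , j≢k = core-fork λ {k} i~k → decidable-stable (Onward? i k) (λ ¬o → none (k , i~k , ¬o))
    in subst₂ (λ x y → x + y ≤ sum (charge i)) (charge-core ij) (charge-core ik) (two-entries≤sum (charge i) j≢k)

  2<charge : ∃ λ i → 2 < sum (charge i)
  2<charge with i , j , k , l , ij , ik , il , j≢k , j≢l , k≢l ← core-branch (on true 0F) =
    i , subst (_≤ sum (charge i)) (cong₂ _+_ (charge-core ij) (cong₂ _+_ (charge-core ik) (charge-core il)))
          (three-entries≤sum (charge i) j≢k j≢l k≢l)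

  edgeCount-lower : n₁ + n₂ < edgeCount H
  edgeCount-lower = *-cancelʳ-< _ (n₁ + n₂) (edgeCount H) (begin-strict
    (n₁ + n₂) * 2              <⟨ sum-lower-strict 2 (sum ∘ charge) 2≤charge (proj₁ 2<charge) (proj₂ 2<charge) ⟩
    total charge               ≤⟨ total-charge≤ ⟩
    edgeCount H + edgeCount H  ≡⟨ cong (edgeCount H +_) (+-identityʳ _) ⟨
    2 * edgeCount H            ≡⟨ *-comm 2 (edgeCount H) ⟩
    edgeCount H * 2            ∎)
    where open ≤-Reasoning

-- Sums, transpositions and cyclic neighbours for the upper bound

sum-split : ∀ m {n} (f : Vector ℕ (m + n)) → sum f ≡ sum (f ∘ (_↑ˡ n)) + sum (f ∘ (m ↑ʳ_))
sum-split zero    f = refl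
sum-split (suc m) f = trans (cong (f zero +_) (sum-split m (f ∘ suc))) (sym (+-assoc (f zero) _ _))

sum-⊎ : ∀ m {n} (f : Fin m ⊎ Fin n → ℕ) → ∑[ i < m + n ] f (splitAt m i) ≡ sum (f ∘ inj₁) + sum (f ∘ inj₂)
sum-⊎ m {n} f = trans (sum-split m (f ∘ splitAt m))
  (cong₂ _+_ (sum-cong-≗ (λ i → cong f (splitAt-↑ˡ m i n))) (sum-cong-≗ (λ j → cong f (splitAt-↑ʳ m n j))))

sum-const : ∀ n k → sum {n} (const k) ≡ n * k
sum-const zero    k = refl
sum-const (suc n) k = cong (k +_) (sum-const n k)

sum-zero : ∀ {n} {f : Vector ℕ n} → (∀ i → f i ≡ 0) → sum f ≡ 0
sum-zero {n} f≡0 = trans (sum-cong-≗ f≡0) (trans (sum-const n 0) (*-zeroʳ n))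

sum-indicator : ∀ {n} (k : Fin n) → sum (λ i → if does (i ≟ k) then 1 else 0) ≡ 1
sum-indicator {suc n} zero = cong suc (sum-zero {n} (λ _ → refl))
sum-indicator (suc k) = sum-indicator k

transpose-injective : ∀ {n} (i j : Fin n) → Injective _≡_ _≡_ (transpose i j)
transpose-injective i j e = trans (sym (transpose-inverse j i)) (trans (cong (transpose j i) e) (transpose-inverse j i))

transpose-first : ∀ {n} (i j : Fin n) → transpose i j i ≡ j
transpose-first i j rewrite dec-true (i ≟ i) refl = refl

transpose-fixes : ∀ {n} (i j : Fin n) {k} → k ≢ i → k ≢ j → transpose i j k ≡ k
transpose-fixes i j {k} k≢i k≢j rewrite dec-false (k ≟ i) k≢i | dec-false (k ≟ j) k≢j = refl

transpose-second : ∀ {n} (i j : Fin n) → transpose i j j ≡ i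
transpose-second i j with j ≟ i
... | yes j≡i = j≡i
... | no _ rewrite dec-true (j ≟ j) refl = refl

override-injective : ∀ {a n} {A : Set a} {f : Vector A n} → Injective _≡_ _≡_ f → ∀ k {v} → (∀ i → f i ≢ v) →
                     Injective _≡_ _≡_ (updateAt f k (const v))
override-injective {f = f} f-injective k {v} f≢v {i} {j} e with i ≟ k | j ≟ k
... | yes i≡k  | yes j≡k  = trans i≡k (sym j≡k)
... | yes refl | no  j≢k  = contradiction (trans (sym (updateAt-minimal j k f j≢k)) (trans (sym e) at-k)) (f≢v j)
  where at-k = updateAt-updates k {const v} f
... | no  i≢k  | yes refl = contradiction (trans (sym (updateAt-minimal i k f i≢k)) (trans e at-k)) (f≢v i)
  where at-k = updateAt-updates k {const v} f
... | no  i≢k  | no  j≢k  =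
  f-injective (trans (sym (updateAt-minimal i k f i≢k)) (trans e (updateAt-minimal j k f j≢k)))

successor : ∀ {r} (k : Fin r) → ∃ λ i → Next k i
successor {suc r} k with suc (toℕ k) <? suc r
... | yes k<r = fromℕ< k<r , inj₁ (toℕ-fromℕ< k<r)
... | no  k≮r = zero , inj₂ (≤-antisym (toℕ<n k) (≮⇒≥ k≮r) , refl)

predecessor : ∀ {r} (k : Fin r) → ∃ λ i → Next i k
predecessor {suc r} zero    = fromℕ r , inj₂ (cong suc (toℕ-fromℕ r) , refl)
predecessor (suc k) = inject₁ k , inj₁ (cong suc (sym (toℕ-inject₁ k)))

-- Two steps return to the start only on a cycle of length at most 2. Hence a vertex of a longer
-- cycle has distinct successor and predecessor.
Next-asym : ∀ {r} {i j : Fin r} → 3 ≤ r → Next i j → ¬ Next j i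
Next-asym 3≤r (inj₁ p) (inj₁ q) = m≢1+n+m _ (trans p (cong suc q))
Next-asym {r} 3≤r (inj₁ p) (inj₂ (q , q′)) = <⇒≱ 3≤r (≤-reflexive (trans (sym q) (cong suc (trans p (cong suc q′)))))
Next-asym 3≤r (inj₂ (p , p′)) (inj₁ q) = <⇒≱ 3≤r (≤-reflexive (trans (sym p) (cong suc (trans q (cong suc p′)))))
Next-asym 3≤r (inj₂ (p , p′)) (inj₂ (q , q′)) = <⇒≱ 3≤r (≤-trans (≤-reflexive (trans (sym q) (cong suc p′))) (s≤s z≤n))

-- Upper bound: the graph and its freeness from C₂ℓ

module Construction (m c d : ℕ) where

  ℓ n₁ n₂ : ℕ
  ℓ = 3 + m
  n₁ = ℓ + c
  n₂ = ℓ + d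

  X Y V : Set
  X = Fin ℓ ⊎ Fin c
  Y = Fin ℓ ⊎ Fin d
  V = X ⊎ Y

  -- The vertex of `A` carrying the pendant vertices of `Y`. It precedes `0F` cyclically, and `1F`
  -- follows `0F`, so the closing cycles need changes only near `0F` and `last`.
  last : Fin ℓ
  last = fromℕ (2 + m)

  -- A is Fin ℓ in X, and y₀, attached to 1F, is inj₁ 0F in Y; the other class of K_{ℓ,ℓ-1} is Fin ℓ in Y without 0F.
  link : X → Y → Bool
  link (inj₁ a) (inj₁ zero)    = does (a ≟ 1F)
  link (inj₁ a) (inj₁ (suc _)) = true
  link (inj₁ a) (inj₂ _)       = does (a ≟ last)
  link (inj₂ _) (inj₁ zero)    = true
  link (inj₂ _) (inj₁ (suc _)) = false
  link (inj₂ _) (inj₂ _)       = false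

  adjacent : V → V → Bool
  adjacent (inj₁ x) (inj₂ y) = link x y
  adjacent (inj₂ y) (inj₁ x) = link x y
  adjacent (inj₁ _) (inj₁ _) = false
  adjacent (inj₂ _) (inj₂ _) = false

  left : X → Fin (n₁ + n₂)
  left x = join ℓ c x ↑ˡ n₂

  right : Y → Fin (n₁ + n₂)
  right y = n₁ ↑ʳ join ℓ d y

  encode : V → Fin (n₁ + n₂)
  encode (inj₁ x) = left x
  encode (inj₂ y) = right y

  decode : Fin (n₁ + n₂) → V
  decode = Sum.map (splitAt ℓ) (splitAt ℓ) ∘ splitAt n₁

  decode-encode : ∀ v → decode (encode v) ≡ v
  decode-encode (inj₁ x) rewrite splitAt-↑ˡ n₁ (join ℓ c x) n₂ | splitAt-join ℓ c x = refl
  decode-encode (inj₂ y) rewrite splitAt-↑ʳ n₁ n₂ (join ℓ d y) | splitAt-join ℓ d y = refl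

  encode-decode : ∀ i → encode (decode i) ≡ i
  encode-decode i with splitAt n₁ i in eq
  ... | inj₁ x = trans (cong (_↑ˡ n₂) (join-splitAt ℓ c x)) (trans (cong (join n₁ n₂) (sym eq)) (join-splitAt n₁ n₂ i))
  ... | inj₂ y = trans (cong (n₁ ↑ʳ_) (join-splitAt ℓ d y)) (trans (cong (join n₁ n₂) (sym eq)) (join-splitAt n₁ n₂ i))

  encode-injective : Injective _≡_ _≡_ encode
  encode-injective {v} {w} e = trans (sym (decode-encode v)) (trans (cong decode e) (decode-encode w))

  decode-injective : Injective _≡_ _≡_ decode
  decode-injective {i} {j} e = trans (sym (encode-decode i)) (trans (cong encode e) (encode-decode j))

  H : Adj (n₁ + n₂)
  H i j = adjacent (decode i) (decode j)

  H-encode : ∀ v w → H (encode v) (encode w) ≡ adjacent v w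
  H-encode v w = cong₂ adjacent (decode-encode v) (decode-encode w)

  adjacent-sym : ∀ v w → adjacent v w ≡ adjacent w v
  adjacent-sym (inj₁ _) (inj₁ _) = refl
  adjacent-sym (inj₁ _) (inj₂ _) = refl
  adjacent-sym (inj₂ _) (inj₁ _) = refl
  adjacent-sym (inj₂ _) (inj₂ _) = refl

  adjacent-irrefl : ∀ v → adjacent v v ≡ false
  adjacent-irrefl (inj₁ _) = refl
  adjacent-irrefl (inj₂ _) = refl

  H-sym : ∀ i j → H i j ≡ H j i
  H-sym i j = adjacent-sym (decode i) (decode j)

  isLeft : V → Bool
  isLeft (inj₁ _) = true
  isLeft (inj₂ _) = false

  side-decode : ∀ i → side n₁ i ≡ isLeft (decode i)
  side-decode i = trans (cong (side n₁) (sym (encode-decode i))) (side-encode (decode i))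
    where
    side-encode : ∀ v → side n₁ (encode v) ≡ isLeft v
    side-encode (inj₁ x) = side-↑ˡ n₂ (join ℓ c x)
    side-encode (inj₂ y) = side-↑ʳ n₁ (join ℓ d y)

  spanning : IsSpanningSubgraph H (K n₁ n₂)
  spanning = (H-sym , adjacent-irrefl ∘ decode) , λ i j e →
    trans (cong₂ _xor_ (side-decode i) (side-decode j)) (opposite (decode i) (decode j) e)
    where
    opposite : ∀ v w → adjacent v w ≡ true → (isLeft v xor isLeft w) ≡ true
    opposite (inj₁ _) (inj₂ _) _ = refl
    opposite (inj₂ _) (inj₁ _) _ = refl

  -- A copy of C₂ℓ lies in the core K_{ℓ,ℓ-1}, which has only 2ℓ - 1 vertices.
  module _ {ψ : Fin (2 * ℓ) → V} (ψ-injective : Injective _≡_ _≡_ ψ)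
           (ψ-edge : ∀ i j → C (2 * ℓ) i j ≡ true → adjacent (ψ i) (ψ j) ≡ true) where

    private
      -- Successor and predecessor of `k` on the cycle would both be sent to `w`.
      not-pendant : ∀ k {w} → (∀ j → adjacent (ψ k) (ψ j) ≡ true → ψ j ≡ w) → ⊥
      not-pendant k only =
        let i , k→i = successor k
            j , j→k = predecessor k
            i≡j = ψ-injective (trans (only i (ψ-edge k i (Next⇒C k→i)))
                    (sym (only j (ψ-edge k j (trans (C-sym _ k j) (Next⇒C j→k))))))
        in Next-asym (≤-trans (m≤m+n 3 m) (m≤m+n ℓ _)) k→i (subst (λ j → Next j k) (sym i≡j) j→k)

      core : Fin ℓ ⊎ Fin (2 + m) → V
      core (inj₁ a) = inj₁ (inj₁ a)
      core (inj₂ b) = inj₂ (inj₁ (suc b))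

      ψ≢x : ∀ k x → ψ k ≢ inj₁ (inj₂ x)
      ψ≢x k x e = not-pendant k (λ j → only (ψ j) ∘ subst (λ v → adjacent v (ψ j) ≡ true) e)
        where
        only : ∀ w → adjacent (inj₁ (inj₂ x)) w ≡ true → w ≡ inj₂ (inj₁ 0F)
        only (inj₂ (inj₁ zero)) _ = refl

      in-core : ∀ k → ∃ λ z → ψ k ≡ core z
      in-core k with ψ k in eq
      ... | inj₁ (inj₁ a)       = inj₁ a , refl
      ... | inj₁ (inj₂ x)       = contradiction eq (ψ≢x k x)
      ... | inj₂ (inj₁ (suc b)) = inj₂ b , refl
      -- The pendant neighbours of `y₀` are already excluded by `ψ≢x`, which leaves only `1F`.
      ... | inj₂ (inj₁ zero)    = ⊥-elim (not-pendant k (λ j → only j ∘ subst (λ v → adjacent v (ψ j) ≡ true) eq))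
        where
        only : ∀ j → adjacent (inj₂ (inj₁ 0F)) (ψ j) ≡ true → ψ j ≡ inj₁ (inj₁ 1F)
        only j e with ψ j in eq′
        ... | inj₁ (inj₁ a) = cong (inj₁ ∘ inj₁) (does-true⁻ (a ≟ 1F) e)
        ... | inj₁ (inj₂ x) = contradiction eq′ (ψ≢x j x)
      ... | inj₂ (inj₂ y)       = ⊥-elim (not-pendant k (λ j → only (ψ j) ∘ subst (λ v → adjacent v (ψ j) ≡ true) eq))
        where
        only : ∀ w → adjacent (inj₂ (inj₂ y)) w ≡ true → w ≡ inj₁ (inj₁ last)
        only (inj₁ (inj₁ a)) e = cong (inj₁ ∘ inj₁) (does-true⁻ (a ≟ last) e)

    no-embedding : ⊥
    no-embedding =
      let i , j , i<j , e = pigeonhole small (join ℓ (2 + m) ∘ proj₁ ∘ in-core)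
          e′ = trans (sym (splitAt-join ℓ (2 + m) _)) (trans (cong (splitAt ℓ) e) (splitAt-join ℓ (2 + m) _))
      in <⇒≢ i<j (ψ-injective (trans (proj₂ (in-core i)) (trans (cong core e′) (sym (proj₂ (in-core j))))))
      where
      small : ℓ + (2 + m) < 2 * ℓ
      small = ≤-reflexive (trans (sym (+-suc ℓ (2 + m))) (cong (ℓ +_) (sym (+-identityʳ ℓ))))

  cycle-free : ¬ ContainsCopy H (C (2 * ℓ))
  cycle-free (φ , φ-injective , φ-edge) = no-embedding {decode ∘ φ} (φ-injective ∘ decode-injective) φ-edge

  -- Every missing edge closes a C₂ℓ

  Linked+ : X → Y → X → Y → Set
  Linked+ x y x′ y′ = link x′ y′ ≡ true ⊎ (x′ ≡ x × y′ ≡ y)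

  ClosesCycle : X → Y → Set
  ClosesCycle x y = ContainsCopy (addEdge H (left x) (right y)) (C (2 * ℓ))

  module _ {x y} (s : Fin ℓ → X) (t : Fin ℓ → Y) (s-injective : Injective _≡_ _≡_ s) (t-injective : Injective _≡_ _≡_ t)
           (s~t : ∀ i → Linked+ x y (s i) (t i)) (t~s : ∀ i j → Next i j → Linked+ x y (s j) (t i)) where

    closing-cycle : ClosesCycle x y
    closing-cycle = alternating-cycle H+ H+-sym (left ∘ s) (right ∘ t)
      (s-injective ∘ inj₁-injective ∘ encode-injective) (t-injective ∘ inj₂-injective ∘ encode-injective)
      (λ i j e → case (encode-injective {inj₁ (s i)} {inj₂ (t j)} e))
      (λ i → linked (s~t i)) (λ {i} {j} n → trans (H+-sym (right (t i)) (left (s j))) (linked (t~s i j n)))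
      where
      H+ = addEdge H (left x) (right y)

      H+-sym : ∀ i j → H+ i j ≡ H+ j i
      H+-sym = addEdge-sym H (left x) (right y) H-sym

      case : ∀ {x′ y′} → ¬ (_≡_ {A = V} (inj₁ x′) (inj₂ y′))
      case ()

      linked : ∀ {x′ y′} → Linked+ x y x′ y′ → H+ (left x′) (right y′) ≡ true
      linked {x′} {y′} (inj₁ e) =
        addEdge-old H (left x) (right y) {left x′} {right y′} (trans (H-encode (inj₁ x′) (inj₂ y′)) e)
      linked (inj₂ (refl , refl)) = addEdge-new H (left x) (right y)

  core-link : ∀ {a b} → b ≢ 0F → link (inj₁ a) (inj₁ b) ≡ true
  core-link {b = zero}  b≢0 = contradiction refl b≢0
  core-link {b = suc _} _   = refl

  last-link : ∀ y → link (inj₁ last) (inj₂ y) ≡ true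
  last-link _ = dec-true (last ≟ last) refl

  Next-0F : ∀ {j : Fin ℓ} → Next 0F j → j ≡ 1F
  Next-0F (inj₁ e) = toℕ-injective e

  Next-last : ∀ {j : Fin ℓ} → Next last j → j ≡ 0F
  Next-last {j} (inj₁ e) = contradiction (toℕ<n j) (<-irrefl (trans e (cong suc (toℕ-fromℕ (2 + m)))))
  Next-last (inj₂ (_ , e)) = toℕ-injective e

  Next-to-0F : ∀ {i : Fin ℓ} → Next i 0F → i ≡ last
  Next-to-0F (inj₂ (e , _)) = toℕ-injective (trans (suc-injective e) (sym (toℕ-fromℕ (2 + m))))

  -- The cycle runs `a`, `y₀`, `1F` and then through the rest of K_{ℓ,ℓ-1}.
  closes-a-0 : ∀ {a} → a ≢ 1F → ClosesCycle (inj₁ a) (inj₁ 0F)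
  closes-a-0 {a} a≢1 = closing-cycle (inj₁ ∘ transpose 0F a) inj₁
    (transpose-injective 0F a ∘ inj₁-injective) inj₁-injective
    (λ { zero → inj₂ (cong inj₁ (transpose-first 0F a) , refl) ; (suc _) → inj₁ refl })
    λ { zero j n → inj₁ (dec-true (transpose 0F a j ≟ 1F)
          (trans (cong (transpose 0F a) (Next-0F n)) (transpose-fixes 0F a (λ ()) (a≢1 ∘ sym))))
      ; (suc _) j n → inj₁ refl }

  -- The cycle visits all of K_{ℓ,ℓ-1}, goes from `last` to its pendant `y`, and returns to `a` by
  -- the new edge. The transposition moves `y₀` to the final place, where `y` overwrites it.
  closes-a-y : ∀ {a y} → a ≢ last → ClosesCycle (inj₁ a) (inj₂ y)
  closes-a-y {a} {y} a≢last = closing-cycle s t (transpose-injective 0F a ∘ inj₁-injective)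
      (override-injective (transpose-injective 0F last ∘ inj₁-injective) last (λ _ ())) s~t t~s
    where
    s : Fin ℓ → X
    s = inj₁ ∘ transpose 0F a

    t₀ t : Fin ℓ → Y
    t₀ = inj₁ ∘ transpose 0F last
    t = updateAt t₀ last (const (inj₂ y))

    t-last : t last ≡ inj₂ y
    t-last = updateAt-updates last t₀

    core : ∀ {i j} → i ≢ last → link (s j) (t i) ≡ true
    core {i} {j} i≢last = trans (cong (link (s j)) (updateAt-minimal i last t₀ i≢last))
      (core-link (λ e → i≢last (transpose-injective 0F last (trans e (sym (transpose-second 0F last))))))

    s~t : ∀ i → Linked+ (inj₁ a) (inj₂ y) (s i) (t i)
    s~t i with i ≟ last
    ... | no  i≢last = inj₁ (core {i} {i} i≢last)
    ... | yes refl   = inj₁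
      (trans (cong₂ link (cong inj₁ (transpose-fixes 0F a (λ ()) (a≢last ∘ sym))) t-last) (last-link y))

    t~s : ∀ i j → Next i j → Linked+ (inj₁ a) (inj₂ y) (s j) (t i)
    t~s i j n with i ≟ last
    ... | no  i≢last = inj₁ (core {i} {j} i≢last)
    ... | yes refl   = inj₂ (trans (cong s (Next-last n)) (cong inj₁ (transpose-first 0F a)) , t-last)

  -- The pendant `x` takes the place of `0F`, so that the cycle can begin `x`, `y₀`, `1F`.
  detour : Fin c → Fin ℓ → X
  detour x = updateAt inj₁ 0F (const (inj₂ x))

  detour-injective : ∀ x → Injective _≡_ _≡_ (detour x)
  detour-injective x = override-injective inj₁-injective 0F (λ _ ())

  -- `suc b` is swapped into the final place, after `last`, where the new edge leads back to `x`.
  closes-x-b : ∀ {x b} → ClosesCycle (inj₂ x) (inj₁ (suc b))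
  closes-x-b {x} {b} = closing-cycle (detour x) t (detour-injective x)
      (transpose-injective last (suc b) ∘ inj₁-injective) s~t t~s
    where
    t : Fin ℓ → Y
    t = inj₁ ∘ transpose last (suc b)

    t0 : t 0F ≡ inj₁ 0F
    t0 = cong inj₁ (transpose-fixes last (suc b) (λ ()) (λ ()))

    core : ∀ a i → i ≢ 0F → link (inj₁ a) (t i) ≡ true
    core a i i≢0 = core-link (λ e → i≢0 (transpose-injective last (suc b) (trans e (sym (inj₁-injective t0)))))

    s~t : ∀ i → Linked+ (inj₂ x) (inj₁ (suc b)) (detour x i) (t i)
    s~t zero    = inj₁ (cong (link (inj₂ x)) t0)
    s~t (suc i) = inj₁ (core (suc i) (suc i) λ ())

    t~s : ∀ i j → Next i j → Linked+ (inj₂ x) (inj₁ (suc b)) (detour x j) (t i)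
    t~s i zero n = inj₂ (refl , cong inj₁
      (trans (cong (transpose last (suc b)) (Next-to-0F n)) (transpose-first last (suc b))))
    t~s zero (suc j) n = inj₁ (trans (cong₂ (link ∘ inj₁) (Next-0F n) t0) refl)
    t~s (suc i) (suc j) n = inj₁ (core (suc j) (suc i) λ ())

  -- The cycle ends with `last` and its pendant `y`, and the new edge leads back to `x`.
  closes-x-y : ∀ {x y} → ClosesCycle (inj₂ x) (inj₂ y)
  closes-x-y {x} {y} = closing-cycle (detour x) t (detour-injective x)
      (override-injective inj₁-injective last (λ _ ())) s~t t~s
    where
    t : Fin ℓ → Y
    t = updateAt inj₁ last (const (inj₂ y))

    t-last : t last ≡ inj₂ y
    t-last = updateAt-updates last inj₁

    core : ∀ {a i} → suc i ≢ last → link (inj₁ a) (t (suc i)) ≡ true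
    core {a} {i} i≢last = cong (link (inj₁ a)) (updateAt-minimal (suc i) last inj₁ i≢last)

    s~t : ∀ i → Linked+ (inj₂ x) (inj₂ y) (detour x i) (t i)
    s~t zero    = inj₁ refl
    s~t (suc i) with suc i ≟ last
    ... | no  i≢last = inj₁ (core i≢last)
    ... | yes refl   = inj₁ (trans (cong (link (inj₁ last)) t-last) (last-link y))

    t~s : ∀ i j → Next i j → Linked+ (inj₂ x) (inj₂ y) (detour x j) (t i)
    t~s i zero n = inj₂ (refl , trans (cong t (Next-to-0F n)) t-last)
    t~s zero (suc j) n = inj₁ (cong (λ a → link (inj₁ a) (inj₁ 0F)) (Next-0F n))
    t~s (suc i) (suc j) n with suc i ≟ last
    ... | no  i≢last = inj₁ (core i≢last)
    ... | yes i≡last with () ← Next-last (subst (λ i → Next i (suc j)) i≡last n)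

  closes : ∀ x y → link x y ≡ false → ClosesCycle x y
  closes (inj₁ a) (inj₁ zero)    e = closes-a-0 λ a≡1 → contradiction (trans (sym e) (dec-true (a ≟ 1F) a≡1)) λ ()
  closes (inj₁ a) (inj₂ y)       e = closes-a-y λ a≡l → contradiction (trans (sym e) (dec-true (a ≟ last) a≡l)) λ ()
  closes (inj₂ x) (inj₁ (suc b)) _ = closes-x-b
  closes (inj₂ x) (inj₂ y)       _ = closes-x-y

  saturated : IsSaturated (K n₁ n₂) (C (2 * ℓ)) H
  saturated = spanning , cycle-free , λ u v Kuv Huv≡f →
    subst₂ (λ u v → ContainsCopy (addEdge H u v) (C (2 * ℓ))) (encode-decode u) (encode-decode v)
      (adds (decode u) (decode v) (trans (sym (cong₂ _xor_ (side-decode u) (side-decode v))) Kuv) Huv≡f)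
    where
    adds : ∀ v w → (isLeft v xor isLeft w) ≡ true → adjacent v w ≡ false →
           ContainsCopy (addEdge H (encode v) (encode w)) (C (2 * ℓ))
    adds (inj₁ x) (inj₂ y) _ e = closes x y e
    adds (inj₂ y) (inj₁ x) _ e =
      let φ , φ-injective , φ-edge = closes x y e
      in φ , φ-injective , λ i j ij →
        trans (cong (H (φ i) (φ j) ∨_) (∨-comm (does (φ i ≟ right y) ∧ _) _)) (φ-edge i j ij)

  -- Number of edges of the construction

  edge : Fin (n₁ + n₂) → Fin (n₁ + n₂) → ℕ
  edge = edgeIndicator H

  indicator : X → Y → ℕ
  indicator x y = if link x y then 1 else 0

  -- Indices on the left precede those on the right, so each edge is counted in the row of its left
  -- end. Summing by columns gives degree `1 + c` for `y₀`, `ℓ` for the other `2 + m` core vertices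
  -- and 1 for each pendant.
  edgeCount-H : edgeCount H ≡ (1 + c) + (2 + m) * ℓ + d
  edgeCount-H = begin
    edgeCount H
      ≡⟨ edgeCount≡∑ H ⟩
    ∑[ i < n₁ + n₂ ] sum (edge i)
      ≡⟨ sum-split n₁ (λ i → sum (edge i)) ⟩
    ∑[ x < n₁ ] sum (edge (x ↑ˡ n₂)) + ∑[ y < n₂ ] sum (edge (n₁ ↑ʳ y))
      ≡⟨ cong₂ _+_ (sum-cong-≗ {n₁} left-degree) (sum-zero {n₂} right-degree) ⟩
    ∑[ x < n₁ ] ∑[ y < n₂ ] indicator (splitAt ℓ x) (splitAt ℓ y) + 0
      ≡⟨ +-identityʳ _ ⟩
    ∑[ x < n₁ ] ∑[ y < n₂ ] indicator (splitAt ℓ x) (splitAt ℓ y)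
      ≡⟨ ∑-comm (λ x y → indicator (splitAt ℓ x) (splitAt ℓ y)) ⟩
    ∑[ y < n₂ ] ∑[ x < n₁ ] indicator (splitAt ℓ x) (splitAt ℓ y)
      ≡⟨ sum-cong-≗ {n₂} (λ y → column (splitAt ℓ y)) ⟩
    ∑[ y < n₂ ] degree (splitAt ℓ y)
      ≡⟨ sum-⊎ ℓ degree ⟩
    ∑[ b < ℓ ] degree (inj₁ b) + ∑[ y < d ] 1
      ≡⟨ cong₂ _+_ (cong (1 + c +_) (sum-const (2 + m) ℓ)) (trans (sum-const d 1) (*-identityʳ d)) ⟩
    (1 + c) + (2 + m) * ℓ + d ∎
    where
    open ≡-Reasoning

    degree : Y → ℕ
    degree (inj₁ zero)    = 1 + c
    degree (inj₁ (suc _)) = ℓ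
    degree (inj₂ _)       = 1

    column : ∀ y → ∑[ x < n₁ ] indicator (splitAt ℓ x) y ≡ degree y
    column y = trans (sum-⊎ ℓ (λ x → indicator x y)) (count y)
      where
      count : ∀ y → sum (λ a → indicator (inj₁ a) y) + sum (λ x → indicator (inj₂ x) y) ≡ degree y
      count (inj₁ zero)    = cong₂ _+_ (sum-indicator {ℓ} 1F) (trans (sum-const c 1) (*-identityʳ c))
      count (inj₁ (suc b)) =
        trans (cong₂ _+_ (trans (sum-const ℓ 1) (*-identityʳ ℓ)) (sum-zero {c} (λ _ → refl))) (+-identityʳ ℓ)
      count (inj₂ y)       = cong₂ _+_ (sum-indicator last) (sum-zero {c} (λ _ → refl))

    edge-≮ : ∀ {i j} → ¬ toℕ i < toℕ j → edge i j ≡ 0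
    edge-≮ {i} {j} i≮j rewrite ¬-not (λ e → i≮j (<ᵇ⇒< (toℕ i) (toℕ j) (≡true⇒T e))) = refl

    edge-≁ : ∀ {i j} → H i j ≡ false → edge i j ≡ 0
    edge-≁ {i} {j} e rewrite e | ∧-zeroʳ (toℕ i <ᵇ toℕ j) = refl

    left<right : ∀ x y → toℕ (x ↑ˡ n₂) < toℕ (n₁ ↑ʳ y)
    left<right x y rewrite toℕ-↑ˡ x n₂ | toℕ-↑ʳ n₁ y = <-≤-trans (toℕ<n x) (m≤m+n n₁ (toℕ y))

    left-degree : ∀ x → sum (edge (x ↑ˡ n₂)) ≡ sum (λ y → indicator (splitAt ℓ x) (splitAt ℓ y))
    left-degree x = trans (sum-split n₁ (edge (x ↑ˡ n₂))) (cong₂ _+_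
      (sum-zero λ x′ → edge-≁ {x ↑ˡ n₂} {x′ ↑ˡ n₂} (LL x′)) (sum-cong-≗ LR))
      where
      LL : ∀ x′ → H (x ↑ˡ n₂) (x′ ↑ˡ n₂) ≡ false
      LL x′ rewrite splitAt-↑ˡ n₁ x n₂ | splitAt-↑ˡ n₁ x′ n₂ = refl

      LR : ∀ y → edge (x ↑ˡ n₂) (n₁ ↑ʳ y) ≡ indicator (splitAt ℓ x) (splitAt ℓ y)
      LR y rewrite T⇒≡true (<⇒<ᵇ (left<right x y)) | splitAt-↑ˡ n₁ x n₂ | splitAt-↑ʳ n₁ n₂ y = refl

    right-degree : ∀ y → sum (edge (n₁ ↑ʳ y)) ≡ 0
    right-degree y = trans (sum-split n₁ (edge (n₁ ↑ʳ y))) (cong₂ _+_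
      (sum-zero λ x → edge-≮ {n₁ ↑ʳ y} {x ↑ˡ n₂} (<⇒≯ (left<right x y)))
      (sum-zero λ y′ → edge-≁ {n₁ ↑ʳ y} {n₁ ↑ʳ y′} (RR y′)))
      where
      RR : ∀ y′ → H (n₁ ↑ʳ y) (n₁ ↑ʳ y′) ≡ false
      RR y′ rewrite splitAt-↑ʳ n₁ n₂ y | splitAt-↑ʳ n₁ n₂ y′ = refl

  edgeCount-H-closed : edgeCount H ≡ n₁ + n₂ + (ℓ * ℓ ∸ 3 * ℓ) + 1
  -- The truncated difference factors as `(ℓ ∸ 3) * ℓ`, which computes to `m * ℓ`.
  edgeCount-H-closed rewrite edgeCount-H | sym (*-distribʳ-∸ ℓ ℓ 3) = ring m c d
    where
    ring : ∀ m c d → (1 + c) + (2 + m) * (3 + m) + d ≡ (3 + m + c) + (3 + m + d) + m * (3 + m) + 1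
    ring = solve-∀

-- Assembly of the two bounds

satLE-even-cycle : ∀ {ℓ n₁ n₂} → 3 ≤ ℓ → ℓ ≤ n₁ → ℓ ≤ n₂ →
                   SatLE (K n₁ n₂) (C (2 * ℓ)) (n₁ + n₂ + (ℓ * ℓ ∸ 3 * ℓ) + 1)
satLE-even-cycle 3≤ℓ ℓ≤n₁ ℓ≤n₂
  with m , refl ← m≤n⇒∃[o]m+o≡n 3≤ℓ
  with c , refl ← m≤n⇒∃[o]m+o≡n ℓ≤n₁
  with d , refl ← m≤n⇒∃[o]m+o≡n ℓ≤n₂
  = H , saturated , ≤-reflexive edgeCount-H-closed
  where open Construction m c d

theorem1p1 : ((ℓ n₁ n₂ : ℕ) → 3 ≤ ℓ → ℓ + 2 ≤ n₁ → ℓ + 2 ≤ n₂ →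
    SatLE (K n₁ n₂) (C (2 * ℓ)) (n₁ + n₂ + (ℓ * ℓ ∸ 3 * ℓ) + 1))
    × ((n₁ n₂ : ℕ) → 5 ≤ n₁ → 5 ≤ n₂ →
    SatEq (K n₁ n₂) (C 6) (n₁ + n₂ + 1))
theorem1p1 =
    (λ ℓ n₁ n₂ 3≤ℓ ℓ+2≤n₁ ℓ+2≤n₂ → satLE-even-cycle 3≤ℓ (≤-trans (m≤m+n ℓ 2) ℓ+2≤n₁) (≤-trans (m≤m+n ℓ 2) ℓ+2≤n₂))
  , λ n₁ n₂ 5≤n₁ 5≤n₂ →
      let lower : ∀ H → IsSaturated (K n₁ n₂) (C 6) H → n₁ + n₂ + 1 ≤ edgeCount H
          lower H saturated = subst (_≤ edgeCount H) (+-comm 1 (n₁ + n₂))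
            (Saturated.edgeCount-lower H saturated 5≤n₁ 5≤n₂)
          H , saturated , upper = satLE-even-cycle ≤-refl (≤-trans (m≤m+n 3 2) 5≤n₁) (≤-trans (m≤m+n 3 2) 5≤n₂)
          -- At `ℓ = 3` the term `ℓ * ℓ ∸ 3 * ℓ` computes to 0.
          upper′ = subst (λ k → edgeCount H ≤ k + 1) (+-identityʳ (n₁ + n₂)) upper
      in (H , saturated , ≤-antisym upper′ (lower H saturated)) , lower
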